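{- For every $\alpha \in (0,\tfrac{1}{2})$ there is a (deterministic, non-clairvoyant) online algorithm for dynamic bin packing that makes at most $\frac{4\alpha}{1-2\alpha}\cdot n$ migrations in total on every instance with $n$ items, and such that at every time $t$ the number of bins it has open is at most $\frac{1}{\alpha}\mathrm{OPT}_t + O(\log \rho)$, where $\rho$ is the maximum number of items simultaneously present in the system at any time (the $O(\cdot)$ hides an absolute constant).
   Context: Dynamic bin packing: bins have capacity $1$. Items $i=1,\dots,n$ arrive online at arrival times $a_i\ge 0$, with size $s_i\in[0,1]$ and duration $d_i>0$; item $i$ is present in the system during $[a_i,a_i+d_i)$. The algorithm is non-clairvoyant: at arrival only $s_i$ is revealed, not $d_i$. Upon arrival the algorithm must place the item into an open bin whose current load (total size of the items it contains) plus $s_i$ is at most $1$, or open a new bin for it. A migration moves an already placed item from its bin to another bin (respecting capacity); the number of migrations is the total number of such moves. A bin is open while it contains at least one item. $\mathrm{OPT}_t$ denotes the minimum number of unit-capacity bins needed to pack the items present in the system at time $t$. -}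

module Defs where

open import Level using (Level; suc; _⊔_)
open import Algebra.Bundles using (CommutativeRing)
open import Algebra.Structures using (IsCommutativeRing)
import Algebra.Properties.Semiring.Mult as Mult
open import Data.Fin.Base using (Fin; toℕ)
import Data.Fin.Properties as Fin
open import Data.List.Base using (List; []; _∷_; _++_; map; filter; foldr; length; lookup; allFin; reverse; deduplicate)
open import Data.List.Membership.Propositional using (_∈_)
import Data.List.Sort as Sort
open import Data.Nat.Base as ℕ using (ℕ)
import Data.Nat.Properties as ℕ
open import Data.Product.Base using (Σ-syntax; ∃-syntax; _×_; _,_)
open import Data.Product.Relation.Binary.Lex.NonStrict using (×-decTotalOrder)
open import Data.Unit.Polymorphic.Base using (⊤)
open import Relation.Binary.Bundles using (DecTotalOrder)
open import Relation.Binary.Core using (Rel)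
open import Relation.Binary.Structures using (IsDecTotalOrder)
import Relation.Binary.Construct.On as On
import Relation.Binary.Construct.NonStrictToStrict as Strict
open import Relation.Binary.PropositionalEquality.Core using (_≡_; _≢_)
open import Relation.Nullary.Decidable using (Dec; yes; no; ¬?; _×-dec_)
open import Relation.Unary using (Pred)

private
  variable
    c ℓ p : Level

-- Stands in for ℝ: a totally ordered field with decidable comparisons.
record OrderedField (c ℓ : Level) : Set (suc (c ⊔ ℓ)) where
  infix  4 _≤_
  infixl 6 _+_
  infixl 7 _*_
  infix  8 -_
  infix  9 _⁻¹
  field
    Carrier           : Set c
    _≤_               : Rel Carrier ℓ
    _+_ _*_           : Carrier → Carrier → Carrier
    -_ _⁻¹            : Carrier → Carrier
    0# 1#             : Carrier
    isCommutativeRing : IsCommutativeRing _≡_ _+_ _*_ -_ 0# 1#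
    0≢1               : 0# ≢ 1#
    -- 0# ⁻¹ is unconstrained
    *-inverseʳ        : ∀ x → x ≢ 0# → x * x ⁻¹ ≡ 1#
    isDecTotalOrder   : IsDecTotalOrder _≡_ _≤_
    +-monoˡ-≤         : ∀ {x y} z → x ≤ y → x + z ≤ y + z
    *-nonneg          : ∀ {x y} → 0# ≤ x → 0# ≤ y → 0# ≤ x * y

  commutativeRing : CommutativeRing c c
  commutativeRing = record { isCommutativeRing = isCommutativeRing }

  decTotalOrder : DecTotalOrder c c ℓ
  decTotalOrder = record { isDecTotalOrder = isDecTotalOrder }

  open IsDecTotalOrder isDecTotalOrder public using (_≟_; _≤?_)
  open Strict _≡_ _≤_ public using (_<_)

  infix 4 _<?_
  _<?_ : ∀ x y → Dec (x < y)
  _<?_ = Strict.<-decidable _≡_ _≤_ _≟_ _≤?_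

  infixl 6 _-_
  _-_ : Carrier → Carrier → Carrier
  x - y = x + - y

  infixl 7 _/_
  _/_ : Carrier → Carrier → Carrier
  x / y = x * y ⁻¹

  fromℕ : ℕ → Carrier
  fromℕ n = n · 1#
    where open Mult (CommutativeRing.semiring commutativeRing) renaming (_×_ to _·_)

  sum : List Carrier → Carrier
  sum = foldr _+_ 0#

IsMinimum : Pred ℕ p → Pred ℕ p
IsMinimum P m = P m × (∀ k → P k → m ℕ.≤ k)

IsMaximum : Pred ℕ p → Pred ℕ p
IsMaximum P m = P m × (∀ k → P k → k ℕ.≤ m)

module BinPacking (F : OrderedField c ℓ) where
  open OrderedField F

  record Instance (n : ℕ) : Set (c ⊔ ℓ) where
    field
      arrival size duration : Fin n → Carrier
      0≤arrival  : ∀ i → 0# ≤ arrival i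
      0≤size     : ∀ i → 0# ≤ size i
      size≤1     : ∀ i → size i ≤ 1#
      0<duration : ∀ i → 0# < duration i

    departure : Fin n → Carrier
    departure i = arrival i + duration i

    Present : Carrier → Pred (Fin n) (c ⊔ ℓ)
    Present t i = arrival i ≤ t × t < departure i

    present? : ∀ t i → Dec (Present t i)
    present? t i = (arrival i ≤? t) ×-dec (t <? departure i)

    present : Carrier → List (Fin n)
    present t = filter (present? t) (allFin n)

  Packable : List Carrier → Pred ℕ ℓ
  Packable sizes m =
    Σ[ bin ∈ (Fin (length sizes) → Fin m) ]
      (∀ b → sum (map (lookup sizes) (filter (λ k → bin k Fin.≟ b) (allFin (length sizes)))) ≤ 1#)

  IsOPT : ∀ {n} → Instance n → Carrier → Pred ℕ ℓ
  IsOPT I t = IsMinimum (Packable (map size (present t)))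
    where open Instance I

  IsPeak : ∀ {n} → Instance n → Pred ℕ c
  IsPeak I = IsMaximum (λ k → ∃[ t ] length (present t) ≡ k)
    where open Instance I

  -- Everything an algorithm ever learns.  Items are referred to by their index
  -- in the instance; an arrival does not disclose the duration.
  data Observation : Set c where
    arrives : (time : Carrier) (item : ℕ) (size : Carrier) → Observation
    departs : (time : Carrier) (item : ℕ) → Observation

  time : Observation → Carrier
  time (arrives t _ _) = t
  time (departs t _)   = t

  -- Chronological order. An item occupies the half-open interval [a , a + d),
  -- so at equal times departures precede arrivals; remaining ties go by index.
  observationOrder : DecTotalOrder c c (c ⊔ ℓ)
  observationOrder =
    On.decTotalOrder (×-decTotalOrder decTotalOrder (×-decTotalOrder ℕ.≤-decTotalOrder ℕ.≤-decTotalOrder)) key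
    where
    key : Observation → Carrier × ℕ × ℕ
    key (departs t i)   = t , 0 , i
    key (arrives t i _) = t , 1 , i

  timeline : ∀ {n} → Instance n → List Observation
  timeline {n} I = Sort.sort observationOrder
    (map (λ i → arrives (arrival i) (toℕ i) (size i)) (allFin n) ++
     map (λ i → departs (departure i) (toℕ i)) (allFin n))
    where open Instance I

  -- Histories are listed latest observation first.
  History : Set c
  History = List Observation

  fullHistory : ∀ {n} → Instance n → History
  fullHistory I = reverse (timeline I)

  historyAt : ∀ {n} → Instance n → Carrier → History
  historyAt I t = reverse (filter (λ o → time o ≤? t) (timeline I))

  -- Bins are labelled by natural numbers; using a label whose bin is currently
  -- empty amounts to opening a new bin.
  Bin : Set
  Bin = ℕ

  record Migration : Set where
    constructor _to_
    field
      item   : ℕ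
      target : Bin

  -- Deterministic, online and non-clairvoyant: decisions are functions of the
  -- observations made so far.
  record Algorithm : Set c where
    field
      place   : (past : History) (time : Carrier) (item : ℕ) (size : Carrier) → Bin
      -- Performed in list order once the latest observation has taken effect.
      migrate : History → List Migration

  record Placed : Set c where
    constructor placed
    field
      item : ℕ
      size : Carrier
      bin  : Bin
  open Placed

  Configuration : Set c
  Configuration = List Placed

  load : Bin → Configuration → Carrier
  load b C = sum (map size (filter (λ q → bin q ℕ.≟ b) C))

  openBins : Configuration → ℕ
  openBins C = length (deduplicate ℕ._≟_ (map bin C))

  applyMigration : Migration → Configuration → Configuration
  applyMigration (i to b) = map move
    where
    move : Placed → Placed
    move q with item q ℕ.≟ i
    ... | yes _ = placed (item q) (size q) b
    ... | no  _ = q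

  applyMigrations : List Migration → Configuration → Configuration
  applyMigrations []       C = C
  applyMigrations (m ∷ ms) C = applyMigrations ms (applyMigration m C)

  LegalMigration : Migration → Configuration → Set (c ⊔ ℓ)
  LegalMigration (i to b) C =
    ∃[ q ] (q ∈ C × item q ≡ i × bin q ≢ b × load b C + size q ≤ 1#)

  LegalMigrations : List Migration → Configuration → Set (c ⊔ ℓ)
  LegalMigrations []       C = ⊤
  LegalMigrations (m ∷ ms) C = LegalMigration m C × LegalMigrations ms (applyMigration m C)

  module _ (A : Algorithm) where
    open Algorithm A

    observe : Observation → History → Configuration → Configuration
    observe (arrives t i s) past C = placed i s (place past t i s) ∷ C
    observe (departs t i)   past C = filter (λ q → ¬? (item q ℕ.≟ i)) C

    LegalObserve : Observation → History → Configuration → Set ℓ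
    LegalObserve (arrives t i s) past C = load (place past t i s) C + s ≤ 1#
    LegalObserve (departs t i)   past C = ⊤

    configuration : History → Configuration
    configuration []         = []
    configuration (o ∷ past) =
      applyMigrations (migrate (o ∷ past)) (observe o past (configuration past))

    migrations : History → ℕ
    migrations []         = 0
    migrations (o ∷ past) = length (migrate (o ∷ past)) ℕ.+ migrations past

    Legal : History → Set (c ⊔ ℓ)
    Legal []         = ⊤
    Legal (o ∷ past) =
      Legal past ×
      LegalObserve o past (configuration past) ×
      LegalMigrations (migrate (o ∷ past)) (observe o past (configuration past))

{-# OPTIONS --safe #-}
-- Items are sorted into size classes (2⁻ᵏ⁻¹ , 2⁻ᵏ], and each bin holds items of one class only, filled
-- by first fit.  An item smaller than every class up to ⌊log₂ (number of items present)⌋ is tiny: so few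
-- items are present that all the tiny ones of that level fit into one bin, which is never touched by
-- migrations.  When a departure leaves two bins of a class with load below α < 1/2, one is emptied
-- into the other.  Hence at most one bin per class and level is lighter than α, and the others number
-- at most OPT / α.
--
-- A new bin of a class is opened only when the other bins of the class are half full, so all but one of
-- them fell below α by losing load at least 1/2 − α, that is by (1/2 − α)·2ᵏ departures.  These pay for the
-- at most α·2ᵏ⁺¹ migrations of a merge, which gives the ratio 4α / (1 − 2α).
module Submission where

open import Algebra.Bundles using (CommutativeRing)
import Algebra.Properties.Ring as Ring
import Algebra.Properties.Semiring.Mult as Mult
import Algebra.Solver.Ring.NaturalCoefficients.Default as Solver
open import Data.Fin.Base using (Fin; toℕ)
import Data.Fin.Properties as Fin
open import Data.List.Base using (List; []; _∷_; _++_; map; filter; length; lookup; allFin; mapMaybe; reverse; deduplicate; upTo)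
open import Data.List.Membership.DecPropositional using (_∈?_)
open import Data.List.Membership.Propositional using (_∈_; _∉_; find; lose)
open import Data.List.Membership.Propositional.Properties using (∈-map⁺; ∈-map⁻; ∈-filter⁺; ∈-filter⁻; ∈-∃++; ∈-allFin; ∈-++⁺ˡ; ∈-++⁺ʳ; ∈-++⁻; ∈-upTo⁺; ∈-deduplicate⁻; ∈-lookup)
open import Data.List.Properties using (filter-++; length-++; length-filter; length-map; map-++; length-deduplicate; tabulate-lookup; map-tabulate; length-tabulate; unfold-reverse; mapMaybe-++; length-upTo; ++-identityʳ)
open import Data.List.Relation.Binary.Permutation.Propositional as ↭ using (_↭_; ↭-refl; ↭-sym; ↭-trans; ↭⇒↭ₛ)
open import Data.List.Relation.Binary.Permutation.Propositional.Properties using (shift; ↭-reverse; ∈-resp-↭; ↭-length; mapMaybe-↭; map⁺; All-resp-↭)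
import Data.List.Relation.Binary.Permutation.Setoid.Properties as PermutationSetoid
import Data.List.Relation.Unary.All as All
open All using (All; []; _∷_)
import Data.List.Relation.Unary.All.Properties as All
import Data.List.Relation.Unary.AllPairs as AllPairs
open AllPairs using (AllPairs; []; _∷_)
import Data.List.Relation.Unary.AllPairs.Properties as AllPairs
open import Data.List.Relation.Unary.Any using (here; there; any?)
import Data.List.Relation.Unary.Sorted.TotalOrder.Properties as Sorted
import Data.List.Relation.Unary.Unique.DecPropositional.Properties as UniqueDec
open import Data.List.Relation.Unary.Unique.Propositional using (Unique)
import Data.List.Relation.Unary.Unique.Propositional.Properties as Unique
import Data.List.Sort as Sort
open import Data.Maybe.Base using (Maybe; just; nothing)
open import Data.Nat.Base as ℕ using (ℕ; zero; suc; z≤n; s≤s; _^_)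
import Data.Nat.ListAction as ListAction
open import Data.Nat.Logarithm using (⌊log₂_⌋; ⌊log₂⌋-mono-≤; ⌊log₂[2^n]⌋≡n)
import Data.Nat.Properties as ℕ
open import Data.Product.Base using (Σ-syntax; ∃-syntax; _×_; _,_; proj₁; proj₂)
open import Data.Sum.Base as Sum using (_⊎_; inj₁; inj₂)
import Data.Sum.Properties as Sum
open import Data.Unit.Polymorphic.Base using (⊤; tt)
import Level
open import Relation.Binary.Bundles using (DecTotalOrder)
open import Relation.Binary.Definitions using (DecidableEquality)
open import Relation.Binary.PropositionalEquality as ≡ using (_≡_; _≢_; refl; sym; trans; cong; cong₂; subst; subst₂)
import Relation.Binary.Reasoning.PartialOrder as PosetReasoning
open import Relation.Nullary using (¬_; Dec; yes; no; contradiction)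
open import Relation.Nullary.Decidable using (¬?; _×-dec_)
open import Relation.Unary using (Pred; Decidable)
open import Defs

-- Each class may keep one light bin and the additive term allows only O(log ρ) of them, so the
-- classes must be cut off. As ρ is unknown online, the cut follows the number of items present at
-- each arrival. Tiny items of different cuts stay apart: a single bin suffices for level j because
-- fewer than 2^(j+1) items are present when an item receives that level. This costs one more bin
-- for each level up to log ρ.
--
-- The obstacle in counting migrations is the newest bin of a class: it may be light without having
-- lost anything, so no departures can pay for emptying it. There is one such exempt bin per class.
-- Of two bins to be merged at least one is not exempt, and its departures pay, whichever of the two
-- is emptied. If the exempt bin is emptied, the target pays, loses its credit and inherits the
-- exemption. Thus no departure is charged twice, and there is never a second exempt bin.
--
-- Arrivals call for no repair: loads only grow, and the companions of a newly opened bin are half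
-- full, hence not light because α < 1/2.

module _ {a} {A : Set a} where

  -- The explicit remainder `zs` lets sums, and not only lengths, be compared between the two lists.
  unique-⊆⇒↭ : {xs ys : List A} → Unique xs → (∀ {x} → x ∈ xs → x ∈ ys) → ∃[ zs ] ys ↭ xs ++ zs
  unique-⊆⇒↭ {[]}     {ys} _  _ = ys , ↭-refl
  unique-⊆⇒↭ {x ∷ xs} {ys} x∷xs!@(_ ∷ xs!) ⊆ys with us , vs , refl ← ∈-∃++ (⊆ys (here refl)) =
    let zs , us++vs↭xs++zs = unique-⊆⇒↭ xs! ⊆us++vs
    in zs , ↭-trans (shift x us vs) (↭.prep x us++vs↭xs++zs)
    where
    ⊆us++vs : ∀ {y} → y ∈ xs → y ∈ us ++ vs
    ⊆us++vs y∈xs with ∈-resp-↭ (shift x us vs) (⊆ys (there y∈xs))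
    ... | here refl = contradiction y∈xs (Unique.Unique[x∷xs]⇒x∉xs x∷xs!)
    ... | there y∈  = y∈

  unique-⊆⇒length≤ : {xs ys : List A} → Unique xs → (∀ {x} → x ∈ xs → x ∈ ys) → length xs ℕ.≤ length ys
  unique-⊆⇒length≤ {xs} {ys} xs! ⊆ys with zs , ys↭ ← unique-⊆⇒↭ xs! ⊆ys =
    subst (length xs ℕ.≤_) (sym (trans (↭-length ys↭) (length-++ xs))) (ℕ.m≤m+n _ _)

  module _ {b} {B : Set b} {f : A → B} where

    unique-map-injective : ∀ {xs x y} → Unique (map f xs) → x ∈ xs → y ∈ xs → f x ≡ f y → x ≡ y
    unique-map-injective _ (here refl) (here refl) _ = refl
    unique-map-injective (fx∉ ∷ _) (here refl) (there y∈) fx≡fy =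
      contradiction fx≡fy (All.lookup fx∉ (∈-map⁺ f y∈))
    unique-map-injective (fy∉ ∷ _) (there x∈) (here refl) fx≡fy =
      contradiction (sym fx≡fy) (All.lookup fy∉ (∈-map⁺ f x∈))
    unique-map-injective (_ ∷ u) (there x∈) (there y∈) = unique-map-injective u x∈ y∈

    unique-map⁺ : ∀ {xs} → Unique xs → (∀ {x y} → x ∈ xs → y ∈ xs → f x ≡ f y → x ≡ y) → Unique (map f xs)
    unique-map⁺ [] _ = []
    unique-map⁺ (x∉ ∷ xs!) inj =
      All.map⁺ (All.tabulate (λ y∈ fx≡fy → All.lookup x∉ y∈ (inj (here refl) (there y∈) fx≡fy)))
      ∷ unique-map⁺ xs! (λ x∈ y∈ → inj (there x∈) (there y∈))

    unique-map-filter : ∀ {p} {P : Pred A p} (P? : Decidable P) xs → Unique (map f xs) → Unique (map f (filter P? xs))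
    unique-map-filter P? []       _          = []
    unique-map-filter P? (x ∷ xs) (fx∉ ∷ u) with P? x
    ... | no  _ = unique-map-filter P? xs u
    ... | yes _ = All.map⁺ (All.filter⁺ P? (All.map⁻ fx∉)) ∷ unique-map-filter P? xs u

  length-filter-split : ∀ {p} {P : Pred A p} (P? : Decidable P) xs →
    length xs ≡ length (filter P? xs) ℕ.+ length (filter (λ x → ¬? (P? x)) xs)
  length-filter-split P? []       = refl
  length-filter-split P? (x ∷ xs) with P? x
  ... | yes _ = cong suc (length-filter-split P? xs)
  ... | no  _ = trans (cong suc (length-filter-split P? xs)) (sym (ℕ.+-suc _ _))

  length-filter-filter : ∀ {p q} {P : Pred A p} {Q : Pred A q} (P? : Decidable P) (Q? : Decidable Q) →
    (∀ {x} → P x → Q x) → ∀ xs → length (filter P? xs) ℕ.≤ length (filter P? (filter Q? xs))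
  length-filter-filter P? Q? P⇒Q []       = z≤n
  length-filter-filter P? Q? P⇒Q (x ∷ xs) with ih ← length-filter-filter P? Q? P⇒Q xs | Q? x
  ... | no ¬Qx with P? x
  ...   | yes Px = contradiction (P⇒Q Px) ¬Qx
  ...   | no  _  = ih
  length-filter-filter P? Q? P⇒Q (x ∷ xs) | yes _ with P? x
  ...   | yes _ = s≤s ih
  ...   | no  _ = ih

  unique-resp-↭ : {xs ys : List A} → xs ↭ ys → Unique xs → Unique ys
  unique-resp-↭ xs↭ys = PermutationSetoid.Unique-resp-↭ (≡.setoid A) (↭⇒↭ₛ xs↭ys)

  allPairs-reverse : ∀ {r} {R : A → A → Set r} xs → AllPairs R xs → AllPairs (λ x y → R y x) (reverse xs)
  allPairs-reverse []       []         = []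
  allPairs-reverse {R = R} (x ∷ xs) (Rx ∷ Rxs) = subst (AllPairs (λ x y → R y x)) (sym (unfold-reverse x xs))
    (AllPairs.++⁺ (allPairs-reverse xs Rxs) ([] ∷ []) (All.map (_∷ []) (All-resp-↭ (↭-sym (↭-reverse xs)) Rx)))

∈⇒≤sum : ∀ {n ns} → n ∈ ns → n ℕ.≤ ListAction.sum ns
∈⇒≤sum (here refl) = ℕ.m≤m+n _ _
∈⇒≤sum {ns = m ∷ _} (there n∈) = ℕ.≤-trans (∈⇒≤sum n∈) (ℕ.m≤n+m _ m)

n<2^[1+⌊log₂n⌋] : ∀ n → n ℕ.< 2 ^ suc ⌊log₂ n ⌋
n<2^[1+⌊log₂n⌋] n = ℕ.≰⇒> λ 2^≤n → ℕ.<-irrefl refl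
  (subst (ℕ._≤ ⌊log₂ n ⌋) (⌊log₂[2^n]⌋≡n _) (⌊log₂⌋-mono-≤ 2^≤n))

-- Bin labels that encode the class of their bin

Tag : Set
Tag = ℕ ⊎ ℕ

pattern tiny j    = inj₁ j
pattern regular k = inj₂ k

_≟ᵗ_ : DecidableEquality Tag
_≟ᵗ_ = Sum.≡-dec ℕ._≟_ ℕ._≟_

-- Walks through ℕ × ℕ along the antidiagonals, so every first component recurs infinitely often.
cantor : ℕ → ℕ × ℕ
cantor zero = 0 , 0
cantor (suc n) with cantor n
... | zero  , m = suc m , 0
... | suc k , m = k , suc m

cantor-descend : ∀ d {n k m} → cantor n ≡ (d ℕ.+ k , m) → cantor (d ℕ.+ n) ≡ (k , d ℕ.+ m)
cantor-descend zero eq = eq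
cantor-descend (suc d) {n} {k} {m} eq with cantor (d ℕ.+ n) | cantor-descend d {n} {suc k} {m} (trans eq (cong (_, m) (sym (ℕ.+-suc d k))))
... | _ | refl = refl

-- By induction on k. From (k , m) the walk descends k steps to (0 , k + m), jumps to (k + m + 1 ,
-- 0) and descends m steps to (k + 1 , m), which explains the index `m + suc (k + n)`. Starting from
-- `cantor N` makes the index at least N.
cantor-reaches : ∀ k N → ∃[ n ] N ℕ.≤ n × ∃[ m ] cantor n ≡ (k , m)
cantor-reaches zero N with cantor N in eq
... | x , m = x ℕ.+ N , ℕ.m≤n+m N x , x ℕ.+ m , cantor-descend x (trans eq (cong (_, m) (sym (ℕ.+-identityʳ x))))
cantor-reaches (suc k) N with n , N≤n , m , eq ← cantor-reaches k N =
  m ℕ.+ suc (k ℕ.+ n) , ℕ.≤-trans N≤n (ℕ.≤-trans (ℕ.m≤n+m n (suc k)) (ℕ.m≤n+m _ m)) , m ℕ.+ 0 ,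
  cantor-descend m (trans top (cong (_, 0) (trans (cong suc (ℕ.+-comm k m)) (sym (ℕ.+-suc m k)))))
  where
  top : cantor (suc (k ℕ.+ n)) ≡ (suc (k ℕ.+ m) , 0)
  top with cantor (k ℕ.+ n) | cantor-descend k {n} (trans eq (cong (_, m) (sym (ℕ.+-identityʳ k))))
  ... | _ | refl = refl

-- Even numbers 2j code `tiny j`, odd numbers 2k + 1 code `regular k`.
decode : ℕ → Tag
decode 0             = tiny 0
decode 1             = regular 0
decode (suc (suc n)) = Sum.map suc suc (decode n)

decode-surjective : ∀ κ → ∃[ n ] decode n ≡ κ
decode-surjective (tiny zero)       = 0 , refl
decode-surjective (tiny (suc j))    with n , eq ← decode-surjective (tiny j)    = suc (suc n) , cong (Sum.map suc suc) eq
decode-surjective (regular zero)    = 1 , refl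
decode-surjective (regular (suc k)) with n , eq ← decode-surjective (regular k) = suc (suc n) , cong (Sum.map suc suc) eq

-- The tag of a bin is read off its label, so that the algorithm needs no state beyond the configuration.
tag : ℕ → Tag
tag b = decode (proj₁ (cantor b))

-- A label above the sum of all labels in use is none of them, and every tag recurs beyond any
-- bound.
fresh : ∀ κ bs → ∃[ b ] b ∉ bs × tag b ≡ κ
fresh κ bs with n , refl ← decode-surjective κ with b , <b , m , eq ← cantor-reaches n (suc (ListAction.sum bs)) =
  b , (λ b∈bs → ℕ.<⇒≱ <b (∈⇒≤sum b∈bs)) , cong (λ x → decode (proj₁ x)) eq

-- Ordered fields: order arithmetic, powers of two, sums over fibres

module OrderedFieldProperties {c ℓ} (F : OrderedField c ℓ) where
  open OrderedField F
  open CommutativeRing commutativeRing using (ring; semiring; commutativeSemiring; +-comm; +-assoc; +-identityˡ; +-identityʳ; *-identityˡ; *-comm; zeroʳ; distribˡ; -‿inverseʳ; -‿inverseˡ)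
  open Ring ring using (-‿distribˡ-*; -‿involutive)
  open Solver commutativeSemiring public using (solve; _:+_; _:*_; _:=_; con)
  open DecTotalOrder decTotalOrder public using (total; antisym; poset) renaming (refl to ≤-refl; trans to ≤-trans; reflexive to ≤-reflexive)
  open PosetReasoning poset public using (begin_; step-≤; step-≡-⟩; step-≡-⟨; _∎)

  ≡-≤-trans : ∀ {x y z} → x ≡ y → y ≤ z → x ≤ z
  ≡-≤-trans refl y≤z = y≤z

  ≤-≡-trans : ∀ {x y z} → x ≤ y → y ≡ z → x ≤ z
  ≤-≡-trans x≤y refl = x≤y

  ≰⇒> : ∀ {x y} → ¬ x ≤ y → y < x
  ≰⇒> {x} {y} x≰y with total x y
  ... | inj₁ x≤y = contradiction x≤y x≰y
  ... | inj₂ y≤x = y≤x , λ { refl → x≰y ≤-refl }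

  <⇒≱ : ∀ {x y} → x < y → ¬ y ≤ x
  <⇒≱ (x≤y , x≢y) y≤x = x≢y (antisym x≤y y≤x)

  +-monoʳ-≤ : ∀ {x y} z → x ≤ y → z + x ≤ z + y
  +-monoʳ-≤ z x≤y = subst₂ _≤_ (+-comm _ z) (+-comm _ z) (+-monoˡ-≤ z x≤y)

  +-mono-≤ : ∀ {w x y z} → w ≤ x → y ≤ z → w + y ≤ x + z
  +-mono-≤ w≤x y≤z = ≤-trans (+-monoˡ-≤ _ w≤x) (+-monoʳ-≤ _ y≤z)

  +-cancelʳ-≤ : ∀ {x y} z → x + z ≤ y + z → x ≤ y
  +-cancelʳ-≤ {x} {y} z le = subst₂ _≤_ (undo x) (undo y) (+-monoˡ-≤ (- z) le)
    where
    undo : ∀ w → w + z + - z ≡ w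
    undo w = trans (+-assoc w z (- z)) (trans (cong (w +_) (-‿inverseʳ z)) (+-identityʳ w))

  x≤x+y : ∀ {x y} → 0# ≤ y → x ≤ x + y
  x≤x+y 0≤y = ≡-≤-trans (sym (+-identityʳ _)) (+-monoʳ-≤ _ 0≤y)

  x≤y+x : ∀ {x y} → 0# ≤ y → x ≤ y + x
  x≤y+x 0≤y = ≡-≤-trans (sym (+-identityˡ _)) (+-monoˡ-≤ _ 0≤y)

  0≤+ : ∀ {x y} → 0# ≤ x → 0# ≤ y → 0# ≤ x + y
  0≤+ 0≤x 0≤y = ≤-trans 0≤x (x≤x+y 0≤y)

  ≤⇒0≤- : ∀ {x y} → x ≤ y → 0# ≤ y - x
  ≤⇒0≤- {x} x≤y = ≡-≤-trans (sym (-‿inverseʳ x)) (+-monoˡ-≤ (- x) x≤y)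

  *-monoˡ-≤ : ∀ {x y z} → 0# ≤ z → x ≤ y → z * x ≤ z * y
  *-monoˡ-≤ {x} {y} {z} 0≤z x≤y = begin
    z * x                 ≤⟨ x≤y+x (*-nonneg 0≤z (≤⇒0≤- x≤y)) ⟩
    z * (y - x) + z * x   ≡⟨ distribˡ z (y - x) x ⟨
    z * (y + - x + x)     ≡⟨ cong (z *_) (trans (+-assoc y (- x) x) (trans (cong (y +_) (-‿inverseˡ x)) (+-identityʳ y))) ⟩
    z * y                 ∎

  *-monoʳ-≤ : ∀ {x y z} → 0# ≤ z → x ≤ y → x * z ≤ y * z
  *-monoʳ-≤ 0≤z x≤y = subst₂ _≤_ (*-comm _ _) (*-comm _ _) (*-monoˡ-≤ 0≤z x≤y)

  -- In the case y ≤ x, weak monotonicity gives the reverse inequality of the products, so these are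
  -- equal and z can be cancelled by its inverse.
  *-cancelˡ-≤ : ∀ {x y z} → 0# < z → z * x ≤ z * y → x ≤ y
  *-cancelˡ-≤ {x} {y} {z} (0≤z , 0≢z) zx≤zy with total x y
  ... | inj₁ x≤y = x≤y
  ... | inj₂ y≤x = ≤-reflexive (cancel (antisym zx≤zy (*-monoˡ-≤ 0≤z y≤x)))
    where
    undo : ∀ w → z ⁻¹ * (z * w) ≡ w
    undo w = trans (solve 3 (λ i z w → i :* (z :* w) := z :* i :* w) refl (z ⁻¹) z w)
      (trans (cong (_* w) (*-inverseʳ z (λ z≡0 → 0≢z (sym z≡0)))) (*-identityˡ w))
    cancel : z * x ≡ z * y → x ≡ y
    cancel eq = trans (sym (undo x)) (trans (cong (z ⁻¹ *_) eq) (undo y))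

  x*[y/x]≡y : ∀ {x y} → 0# < x → x * (y / x) ≡ y
  x*[y/x]≡y {x} {y} (_ , 0≢x) = trans (solve 3 (λ x y i → x :* (y :* i) := x :* i :* y) refl x y (x ⁻¹))
    (trans (cong (_* y) (*-inverseʳ x (λ x≡0 → 0≢x (sym x≡0)))) (*-identityˡ y))

  0≤1 : 0# ≤ 1#
  0≤1 with total 0# 1#
  ... | inj₁ 0≤1 = 0≤1
  ... | inj₂ 1≤0 = subst (0# ≤_) eq (*-nonneg 0≤-1 0≤-1)
    where
    0≤-1 : 0# ≤ - 1#
    0≤-1 = subst (0# ≤_) (+-identityˡ _) (≤⇒0≤- 1≤0)
    eq : - 1# * - 1# ≡ 1#
    eq = trans (sym (-‿distribˡ-* 1# (- 1#))) (trans (cong -_ (*-identityˡ _)) (-‿involutive 1#))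

  open Mult semiring using (×-homo-+)

  fromℕ-+ : ∀ m n → fromℕ (m ℕ.+ n) ≡ fromℕ m + fromℕ n
  fromℕ-+ m n = ×-homo-+ 1# m n

  0≤fromℕ : ∀ n → 0# ≤ fromℕ n
  0≤fromℕ zero    = ≤-refl
  0≤fromℕ (suc n) = 0≤+ 0≤1 (0≤fromℕ n)

  fromℕ-mono-≤ : ∀ {m n} → m ℕ.≤ n → fromℕ m ≤ fromℕ n
  fromℕ-mono-≤ {n = n} z≤n = 0≤fromℕ n
  fromℕ-mono-≤ (s≤s m≤n)   = +-monoʳ-≤ 1# (fromℕ-mono-≤ m≤n)

  pow2 : ℕ → Carrier
  pow2 k = fromℕ (2 ^ k)

  pow2-suc : ∀ k → pow2 (suc k) ≡ pow2 k + pow2 k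
  pow2-suc k = trans (fromℕ-+ (2 ^ k) _) (cong (λ n → pow2 k + fromℕ n) (ℕ.+-identityʳ (2 ^ k)))

  0<pow2 : ∀ k → 0# < pow2 k
  0<pow2 k = 0≤fromℕ (2 ^ k) , λ 0≡ → 0≢1 (antisym 0≤1 (subst (1# ≤_) (sym 0≡)
    (≤-trans (≤-reflexive (sym (+-identityʳ 1#))) (fromℕ-mono-≤ (ℕ.m^n>0 2 k)))))

  2*x : ∀ x → fromℕ 2 * x ≡ x + x
  2*x x = solve 1 (λ x → (con 1 :+ (con 1 :+ con 0)) :* x := x :+ x) refl x

  4*x : ∀ x → fromℕ 4 * x ≡ (x + x) + (x + x)
  4*x x = solve 1 (λ x → (con 1 :+ (con 1 :+ (con 1 :+ (con 1 :+ con 0)))) :* x := (x :+ x) :+ (x :+ x)) refl x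

  sum-++ : ∀ xs ys → sum (xs ++ ys) ≡ sum xs + sum ys
  sum-++ []       ys = sym (+-identityˡ _)
  sum-++ (x ∷ xs) ys = trans (cong (x +_) (sum-++ xs ys)) (sym (+-assoc x _ _))

  sum-↭ : ∀ {xs ys} → xs ↭ ys → sum xs ≡ sum ys
  sum-↭ ↭.refl         = refl
  sum-↭ (↭.prep x p)   = cong (x +_) (sum-↭ p)
  sum-↭ (↭.swap {xs} {ys} x y p) = trans (cong (λ s → x + (y + s)) (sum-↭ p))
    (solve 3 (λ x y s → x :+ (y :+ s) := y :+ (x :+ s)) refl x y (sum ys))
  sum-↭ (↭.trans p q)  = trans (sum-↭ p) (sum-↭ q)

  module _ {a} {A : Set a} (f : A → Carrier) where

    0≤sum : ∀ {xs} → All (λ x → 0# ≤ f x) xs → 0# ≤ sum (map f xs)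
    0≤sum []           = ≤-refl
    0≤sum (0≤x ∷ 0≤xs) = 0≤+ 0≤x (0≤sum 0≤xs)

    ∈⇒≤Σ : ∀ {xs x} → All (λ x → 0# ≤ f x) xs → x ∈ xs → f x ≤ sum (map f xs)
    ∈⇒≤Σ (_ ∷ 0≤xs) (here refl) = x≤x+y (0≤sum 0≤xs)
    ∈⇒≤Σ (0≤x ∷ 0≤xs) (there x∈)  = ≤-trans (∈⇒≤Σ 0≤xs x∈) (x≤y+x 0≤x)

    sum≤*length : ∀ p xs → All (λ x → p * f x ≤ 1#) xs → p * sum (map f xs) ≤ fromℕ (length xs)
    sum≤*length p []       []            = ≤-reflexive (zeroʳ p)
    sum≤*length p (x ∷ xs) (px≤1 ∷ pxs≤) =
      ≡-≤-trans (distribˡ p (f x) _) (+-mono-≤ px≤1 (sum≤*length p xs pxs≤))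

    length*≤sum : ∀ p xs {y} → All (λ x → y ≤ p * f x) xs → y * fromℕ (length xs) ≤ p * sum (map f xs)
    length*≤sum p []       {y} []          = ≤-reflexive (trans (zeroʳ y) (sym (zeroʳ p)))
    length*≤sum p (x ∷ xs) {y} (y≤ ∷ y≤s) = begin
      y * (1# + fromℕ (length xs))      ≡⟨ solve 2 (λ y n → y :* (con 1 :+ n) := y :+ y :* n) refl y (fromℕ (length xs)) ⟩
      y + y * fromℕ (length xs)         ≤⟨ +-mono-≤ y≤ (length*≤sum p xs y≤s) ⟩
      p * f x + p * sum (map f xs)      ≡⟨ distribˡ p (f x) _ ⟨
      p * sum (map f (x ∷ xs))          ∎

  -- Double counting in both directions: the load of a bin is a fibre sum, with `g` the bin of a
  -- placed item for the algorithm, and the bin assignment of a packing for OPT.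
  module Fibres {a b} {A : Set a} {B : Set b} (_≟B_ : DecidableEquality B) (g : A → B) (f : A → Carrier) where

    fibreSum : B → List A → Carrier
    fibreSum b xs = sum (map f (filter (λ x → g x ≟B b) xs))

    part : A → B → Carrier
    part x b with g x ≟B b
    ... | yes _ = f x
    ... | no  _ = 0#

    fibreSum-∷ : ∀ x xs b → fibreSum b (x ∷ xs) ≡ part x b + fibreSum b xs
    fibreSum-∷ x xs b with g x ≟B b
    ... | yes _ = refl
    ... | no  _ = sym (+-identityˡ _)

    0≤part : ∀ x b → 0# ≤ f x → 0# ≤ part x b
    0≤part x b 0≤fx with g x ≟B b
    ... | yes _ = 0≤fx
    ... | no  _ = ≤-refl

    private
      ΣfibreSum-∷ : ∀ x xs bs →
        sum (map (λ b → fibreSum b (x ∷ xs)) bs) ≡ sum (map (part x) bs) + sum (map (λ b → fibreSum b xs) bs)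
      ΣfibreSum-∷ x xs []       = sym (+-identityˡ _)
      ΣfibreSum-∷ x xs (b ∷ bs) = trans (cong₂ _+_ (fibreSum-∷ x xs b) (ΣfibreSum-∷ x xs bs))
        (solve 4 (λ p q r s → p :+ q :+ (r :+ s) := p :+ r :+ (q :+ s)) refl (part x b) (fibreSum b xs) _ _)

      Σpart-∉ : ∀ x bs → All (g x ≢_) bs → sum (map (part x) bs) ≡ 0#
      Σpart-∉ x []       []          = refl
      Σpart-∉ x (b ∷ bs) (gx≢b ∷ ≢s) with g x ≟B b
      ... | yes gx≡b = contradiction gx≡b gx≢b
      ... | no  _    = trans (+-identityˡ _) (Σpart-∉ x bs ≢s)

      Σpart≤ : ∀ x bs → 0# ≤ f x → Unique bs → sum (map (part x) bs) ≤ f x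
      Σpart≤ x []       0≤fx []          = 0≤fx
      Σpart≤ x (b ∷ bs) 0≤fx (b∉ ∷ bs!) with g x ≟B b
      ... | yes refl = ≤-reflexive (trans (cong (f x +_) (Σpart-∉ x bs b∉)) (+-identityʳ _))
      ... | no  _      = ≡-≤-trans (+-identityˡ _) (Σpart≤ x bs 0≤fx bs!)

      ≤Σpart : ∀ x bs → 0# ≤ f x → g x ∈ bs → f x ≤ sum (map (part x) bs)
      ≤Σpart x (b ∷ bs) 0≤fx gx∈ with g x ≟B b | gx∈
      ... | yes _   | _           = x≤x+y (0≤sum (part x) (All.tabulate {xs = bs} (λ {b} _ → 0≤part x b 0≤fx)))
      ... | no gx≢b | here gx≡b   = contradiction gx≡b gx≢b
      ... | no _    | there gx∈bs = ≤-trans (≤Σpart x bs 0≤fx gx∈bs) (≤-reflexive (sym (+-identityˡ _)))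

    Σfibres≤sum : ∀ xs bs → All (λ x → 0# ≤ f x) xs → Unique bs → sum (map (λ b → fibreSum b xs) bs) ≤ sum (map f xs)
    Σfibres≤sum [] bs _ _ = zeros bs
      where
      zeros : ∀ bs → sum (map (λ b → fibreSum b []) bs) ≤ 0#
      zeros []       = ≤-refl
      zeros (_ ∷ bs) = ≤-trans (≤-reflexive (+-identityˡ _)) (zeros bs)
    Σfibres≤sum (x ∷ xs) bs (0≤fx ∷ 0≤f) bs! =
      ≡-≤-trans (ΣfibreSum-∷ x xs bs) (+-mono-≤ (Σpart≤ x bs 0≤fx bs!) (Σfibres≤sum xs bs 0≤f bs!))

    sum≤Σfibres : ∀ xs bs → All (λ x → 0# ≤ f x) xs → All (λ x → g x ∈ bs) xs → sum (map f xs) ≤ sum (map (λ b → fibreSum b xs) bs)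
    sum≤Σfibres [] bs _ _ = 0≤sum (λ b → fibreSum b []) (All.tabulate {xs = bs} (λ _ → ≤-refl))
    sum≤Σfibres (x ∷ xs) bs (0≤fx ∷ 0≤f) (gx∈ ∷ g∈) =
      ≤-≡-trans (+-mono-≤ (≤Σpart x bs 0≤fx gx∈) (sum≤Σfibres xs bs 0≤f g∈)) (sym (ΣfibreSum-∷ x xs bs))

-- Loads of configurations and the merging of two bins

module Configurations {c ℓ} (F : OrderedField c ℓ) where
  open OrderedField F
  open BinPacking F
  open OrderedFieldProperties F
  open CommutativeRing commutativeRing using (+-assoc; +-comm; +-identityˡ)
  open Placed
  open Fibres ℕ._≟_ bin size using (part; 0≤part) renaming (fibreSum-∷ to load-∷) public

  labels : Configuration → List Bin
  labels = map bin

  inBin : Bin → Configuration → Configuration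
  inBin b = filter (λ q → bin q ℕ.≟ b)

  NonNegative : Configuration → Set _
  NonNegative = All (λ q → 0# ≤ size q)

  ∈-inBin⁻ : ∀ {b q} C → q ∈ inBin b C → q ∈ C × bin q ≡ b
  ∈-inBin⁻ {b} C = ∈-filter⁻ (λ q → bin q ℕ.≟ b)

  ∈-inBin⁺ : ∀ {b q} {C : Configuration} → q ∈ C → bin q ≡ b → q ∈ inBin b C
  ∈-inBin⁺ {b} = ∈-filter⁺ (λ q → bin q ℕ.≟ b)

  load-mono-∷ : ∀ {q} C b → 0# ≤ size q → load b C ≤ load b (q ∷ C)
  load-mono-∷ {q} C b 0≤s = ≤-≡-trans (x≤y+x (0≤part q b 0≤s)) (sym (load-∷ q C b))

  part-≡ : ∀ q → part q (bin q) ≡ size q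
  part-≡ q with bin q ℕ.≟ bin q
  ... | yes _   = refl
  ... | no  ¬eq = contradiction refl ¬eq

  part-≢ : ∀ q {b} → bin q ≢ b → part q b ≡ 0#
  part-≢ q {b} ≢b with bin q ℕ.≟ b
  ... | yes eq = contradiction eq ≢b
  ... | no  _  = refl

  load-∷-≡ : ∀ q C → load (bin q) (q ∷ C) ≡ size q + load (bin q) C
  load-∷-≡ q C = trans (load-∷ q C (bin q)) (cong (_+ load (bin q) C) (part-≡ q))

  load-∷-≢ : ∀ q C {b} → bin q ≢ b → load b (q ∷ C) ≡ load b C
  load-∷-≢ q C {b} ≢b = trans (load-∷ q C b) (trans (cong (_+ load b C) (part-≢ q ≢b)) (+-identityˡ _))

  ∉⇒load≡0 : ∀ C {b} → b ∉ labels C → load b C ≡ 0#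
  ∉⇒load≡0 []      _  = refl
  ∉⇒load≡0 (q ∷ C) b∉ = trans (load-∷-≢ q C (λ eq → b∉ (here (sym eq)))) (∉⇒load≡0 C (λ b∈ → b∉ (there b∈)))

  size≤load : ∀ {C q} → NonNegative C → q ∈ C → size q ≤ load (bin q) C
  size≤load 0≤C q∈C = ∈⇒≤Σ size (All.filter⁺ _ 0≤C) (∈-inBin⁺ q∈C refl)

  load-filter-split : ∀ {p} {P : Pred Placed p} (P? : Decidable P) C b →
    load b C ≡ load b (filter (λ q → ¬? (P? q)) C) + load b (filter P? C)
  load-filter-split P? []      b = sym (+-identityˡ 0#)
  load-filter-split P? (q ∷ C) b with P? q
  ... | no  _ = trans (load-∷ q C b) (trans (cong (part q b +_) (load-filter-split P? C b))
    (trans (sym (+-assoc (part q b) _ _)) (cong (_+ load b (filter P? C)) (sym (load-∷ q (filter (λ q → ¬? (P? q)) C) b)))))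
  ... | yes _ = trans (load-∷ q C b) (trans (cong (part q b +_) (load-filter-split P? C b))
    (trans (solve 3 (λ x m n → x :+ (m :+ n) := m :+ (x :+ n)) refl (part q b) _ _)
      (cong (load b (filter (λ q → ¬? (P? q)) C) +_) (sym (load-∷ q (filter P? C) b)))))

  -- The net effect of a whole merge, free of the intermediate configurations.
  relabel : Bin → Bin → Placed → Placed
  relabel b b′ q with bin q ℕ.≟ b
  ... | yes _ = placed (item q) (size q) b′
  ... | no  _ = q

  load-relabel : ∀ {b b′ x} C → NonNegative C → x ≢ b → load x C ≤ load x (map (relabel b b′) C)
  load-relabel [] _ _ = ≤-refl
  load-relabel {b} {b′} {x} (q ∷ C) (0≤s ∷ 0≤C) x≢b with bin q ℕ.≟ b
  ... | yes refl = ≡-≤-trans (load-∷-≢ q C (λ eq → x≢b (sym eq)))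
    (≤-trans (load-relabel C 0≤C x≢b) (load-mono-∷ {placed (item q) (size q) b′} (map (relabel b b′) C) x 0≤s))
  ... | no  _ = ≡-≤-trans (load-∷ q C x) (≤-≡-trans (+-monoʳ-≤ (part q x) (load-relabel C 0≤C x≢b))
    (sym (load-∷ q (map (relabel b b′) C) x)))

  item-relabel : ∀ b b′ C → map item (map (relabel b b′) C) ≡ map item C
  item-relabel b b′ []      = refl
  item-relabel b b′ (q ∷ C) with bin q ℕ.≟ b
  ... | yes _ = cong (item q ∷_) (item-relabel b b′ C)
  ... | no  _ = cong (item q ∷_) (item-relabel b b′ C)

  ∈-relabel⁻ : ∀ {b b′ q} C → q ∈ map (relabel b b′) C →
    ∃[ q₀ ] q₀ ∈ C × size q ≡ size q₀ × ((bin q₀ ≡ b × bin q ≡ b′) ⊎ (bin q₀ ≢ b × bin q ≡ bin q₀))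
  ∈-relabel⁻ {b} C q∈ with ∈-map⁻ _ q∈
  ... | q₀ , q₀∈ , eq with bin q₀ ℕ.≟ b
  ∈-relabel⁻ C q∈ | q₀ , q₀∈ , refl | yes ≡b = q₀ , q₀∈ , refl , inj₁ (≡b , refl)
  ∈-relabel⁻ C q∈ | q₀ , q₀∈ , refl | no  ≢b = q₀ , q₀∈ , refl , inj₂ (≢b , refl)

  labels-relabel⁻ : ∀ {b b′ x} C → b ≢ b′ → b′ ∈ labels C → x ∈ labels (map (relabel b b′) C) → x ≢ b × x ∈ labels C
  labels-relabel⁻ {b} C b≢b′ b′∈ x∈ with ∈-map⁻ bin x∈
  ... | q , q∈ , refl with ∈-relabel⁻ C q∈
  ... | q₀ , q₀∈ , _ , inj₁ (_ , eq)   = (λ ≡b → b≢b′ (trans (sym ≡b) eq)) , subst (_∈ labels C) (sym eq) b′∈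
  ... | q₀ , q₀∈ , _ , inj₂ (≢b , eq) = (λ ≡b → ≢b (trans (sym eq) ≡b)) , subst (_∈ labels C) (sym eq) (∈-map⁺ bin q₀∈)

  moves : Bin → Bin → Configuration → List Migration
  moves b b′ C = map (λ q → item q to b′) (inBin b C)

  ∈-applyMigration⁺ : ∀ {i b q C} → q ∈ C → item q ≢ i → q ∈ applyMigration (i to b) C
  ∈-applyMigration⁺ {i} {C = q ∷ _} (here refl) ≢i with item q ℕ.≟ i
  ... | yes ≡i = contradiction ≡i ≢i
  ... | no  _  = here refl
  ∈-applyMigration⁺ (there q∈) ≢i = there (∈-applyMigration⁺ q∈ ≢i)

  ∈-applyMigration⁻ : ∀ {i b q} C → q ∈ applyMigration (i to b) C → bin q ≡ b ⊎ (item q ≢ i × q ∈ C)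
  ∈-applyMigration⁻ {i} (q ∷ C) q∈ with item q ℕ.≟ i | q∈
  ... | yes _ | here refl = inj₁ refl
  ... | no ≢i | here refl = inj₂ (≢i , here refl)
  ... | _     | there q∈C with ∈-applyMigration⁻ C q∈C
  ...   | inj₁ eq         = inj₁ eq
  ...   | inj₂ (≢i , q∈C′) = inj₂ (≢i , there q∈C′)

  item-applyMigration : ∀ m C → map item (applyMigration m C) ≡ map item C
  item-applyMigration m []      = refl
  item-applyMigration m@(i to _) (q ∷ C) with item q ℕ.≟ i
  ... | yes _ = cong (item q ∷_) (item-applyMigration m C)
  ... | no  _ = cong (item q ∷_) (item-applyMigration m C)

  -- The conserved total carries the capacity bound through a merge: if both bins fit together at
  -- the start, they do so after every single move.
  load-applyMigration : ∀ {i b b′} C → b ≢ b′ → (∀ {q} → q ∈ C → item q ≡ i → bin q ≡ b) →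
    load b (applyMigration (i to b′) C) + load b′ (applyMigration (i to b′) C) ≡ load b C + load b′ C
  load-applyMigration [] _ _ = refl
  load-applyMigration {i} {b} {b′} (q ∷ C) b≢b′ inb
    with ih ← load-applyMigration {i} C b≢b′ (λ q∈ → inb (there q∈)) | item q ℕ.≟ i
  ... | yes ≡i with refl ← inb (here refl) ≡i =
    trans (cong₂ _+_ (load-∷-≢ q′ C′ (λ eq → b≢b′ (sym eq))) (load-∷-≡ q′ C′))
    (trans (solve 3 (λ x s y → x :+ (s :+ y) := s :+ (x :+ y)) refl (load b C′) (size q) (load b′ C′))
    (trans (cong (size q +_) ih)
    (trans (sym (+-assoc (size q) _ _))
    (sym (cong₂ _+_ (load-∷-≡ q C) (load-∷-≢ q C b≢b′))))))
    where
    C′ = applyMigration (i to b′) C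
    q′ = placed (item q) (size q) b′
  ... | no _ = trans (cong₂ _+_ (load-∷ q C′ b) (load-∷ q C′ b′))
    (trans (shuffle (load b C′) (load b′ C′)) (trans (cong (part q b + part q b′ +_) ih)
    (trans (sym (shuffle (load b C) (load b′ C))) (sym (cong₂ _+_ (load-∷ q C b) (load-∷ q C b′))))))
    where
    C′ = applyMigration (i to b′) C
    shuffle : ∀ x y → part q b + x + (part q b′ + y) ≡ part q b + part q b′ + (x + y)
    shuffle = solve 4 (λ p r x y → p :+ x :+ (r :+ y) := p :+ r :+ (x :+ y)) refl (part q b) (part q b′)

  -- Moving one item ahead of the others leaves the final outcome unchanged, which is what the
  -- induction over the moves needs.
  relabel-applyMigration : ∀ {i b b′} C → b ≢ b′ → (∀ {q} → q ∈ C → item q ≡ i → bin q ≡ b) →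
    map (relabel b b′) (applyMigration (i to b′) C) ≡ map (relabel b b′) C
  relabel-applyMigration [] _ _ = refl
  relabel-applyMigration {i} {b} {b′} (q ∷ C) b≢b′ inb with item q ℕ.≟ i
  ... | no  _  = cong (relabel b b′ q ∷_) (relabel-applyMigration C b≢b′ (λ q∈ → inb (there q∈)))
  ... | yes ≡i = cong₂ _∷_ head (relabel-applyMigration C b≢b′ (λ q∈ → inb (there q∈)))
    where
    head : relabel b b′ (placed (item q) (size q) b′) ≡ relabel b b′ q
    head with b′ ℕ.≟ b | bin q ℕ.≟ b
    ... | yes eq | _     = contradiction (sym eq) b≢b′
    ... | no _   | yes _ = refl
    ... | no _   | no ¬b = contradiction (inb (here refl) ≡i) ¬b

  -- Induction over `Q`, the items that are still in `b`. The next one adds at most `load b C` to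
  -- the target, and the two loads together never exceed 1.
  merge-legal : ∀ {b b′} Q C → b ≢ b′ → NonNegative C → Unique (map item Q) → Unique (map item C) →
    (∀ {q} → q ∈ Q → q ∈ C × bin q ≡ b) → (∀ {q} → q ∈ C → bin q ≡ b → q ∈ Q) → load b C + load b′ C ≤ 1# →
    LegalMigrations (map (λ q → item q to b′) Q) C × applyMigrations (map (λ q → item q to b′) Q) C ≡ map (relabel b b′) C
  merge-legal {b} {b′} [] C b≢b′ _ _ _ _ inQ _ = tt , unchanged C (λ q∈ ≡b → contradiction (inQ q∈ ≡b) λ ())
    where
    unchanged : ∀ C → (∀ {q} → q ∈ C → bin q ≢ b) → C ≡ map (relabel b b′) C
    unchanged []      _  = refl
    unchanged (q ∷ C) ≢b with bin q ℕ.≟ b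
    ... | yes ≡b = contradiction ≡b (≢b (here refl))
    ... | no  _  = cong (q ∷_) (unchanged C (λ q∈ → ≢b (there q∈)))
  merge-legal {b} {b′} (q ∷ Q) C b≢b′ 0≤C (q∉Q ∷ Q!) C! Q⊆C inQ fits with Q⊆C (here refl)
  ... | q∈C , refl =
    let legal , eq = merge-legal Q C′ b≢b′ 0≤C′ Q! (subst Unique (sym (item-applyMigration m C)) C!) Q⊆C′ inQ′
                       (≡-≤-trans (load-applyMigration C b≢b′ inb) fits)
    in ((q , q∈C , refl , b≢b′ , ≤-trans (+-monoʳ-≤ _ (size≤load 0≤C q∈C)) (≡-≤-trans (+-comm _ _) fits)) , legal)
     , trans eq (relabel-applyMigration C b≢b′ inb)
    where
    m  = item q to b′
    C′ = applyMigration m C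
    inb : ∀ {q′} → q′ ∈ C → item q′ ≡ item q → bin q′ ≡ b
    inb q′∈ eq = cong bin (unique-map-injective C! q′∈ q∈C eq)
    0≤C′ : NonNegative C′
    0≤C′ = go C 0≤C
      where
      go : ∀ D → NonNegative D → NonNegative (applyMigration m D)
      go []      []       = []
      go (r ∷ D) (0≤r ∷ 0≤D) with item r ℕ.≟ item q
      ... | yes _ = 0≤r ∷ go D 0≤D
      ... | no  _ = 0≤r ∷ go D 0≤D
    Q⊆C′ : ∀ {r} → r ∈ Q → r ∈ C′ × bin r ≡ b
    Q⊆C′ r∈ with Q⊆C (there r∈)
    ... | r∈C , r≡b = ∈-applyMigration⁺ r∈C (λ eq → All.lookup q∉Q (∈-map⁺ item r∈) (sym eq)) , r≡b
    inQ′ : ∀ {r} → r ∈ C′ → bin r ≡ b → r ∈ Q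
    inQ′ r∈ r≡b with ∈-applyMigration⁻ C r∈
    ... | inj₁ r≡b′ = contradiction (trans (sym r≡b) r≡b′) b≢b′
    ... | inj₂ (≢q , r∈C) with inQ r∈C r≡b
    ...   | here refl  = contradiction refl ≢q
    ...   | there r∈Q = r∈Q

  moves-merge : ∀ {b b′} C → b ≢ b′ → NonNegative C → Unique (map item C) → load b C + load b′ C ≤ 1# →
    LegalMigrations (moves b b′ C) C × applyMigrations (moves b b′ C) C ≡ map (relabel b b′) C
  moves-merge {b} C b≢b′ 0≤C C! = merge-legal (inBin b C) C b≢b′ 0≤C
    (unique-map-filter _ C C!) C! (∈-inBin⁻ C) ∈-inBin⁺

-- The algorithm and its structural invariants

module FirstFitByClass {c ℓ} (F : OrderedField c ℓ) (α : OrderedField.Carrier F) where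
  open OrderedField F
  open BinPacking F
  open OrderedFieldProperties F
  open Configurations F
  open CommutativeRing commutativeRing using (+-comm; +-identityˡ; +-identityʳ; *-identityˡ; *-identityʳ; distribˡ)
  open Placed

  -- The first argument is fuel: classes k, k + 1, ... are tried until one has its lower end below
  -- s, and an item that outlasts the fuel is tiny. Items of size 0 belong to no regular class and
  -- always end as tiny.
  scan : ℕ → ℕ → Carrier → Tag
  scan zero k s with pow2 (suc k) * s ≤? 1#
  ... | yes _ = tiny k
  ... | no  _ = regular k
  scan (suc f) k s with pow2 (suc k) * s ≤? 1#
  ... | yes _ = scan f (suc k) s
  ... | no  _ = regular k

  -- The `suc` counts the arriving item itself, so the whole population including it stays below
  -- 2^(j+1) for the cut-off j.
  classify : Configuration → Carrier → Tag
  classify C s = scan ⌊log₂ suc (length C) ⌋ 0 s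

  Reusable : Configuration → Carrier → Bin → Set ℓ
  Reusable C s b = tag b ≡ classify C s × load b C + s ≤ 1#

  reusable? : ∀ C s → Decidable (Reusable C s)
  reusable? C s b = (tag b ≟ᵗ classify C s) ×-dec (load b C + s ≤? 1#)

  choose : Configuration → Carrier → Bin
  choose C s with any? (reusable? C s) (labels C)
  ... | yes found = proj₁ (find found)
  ... | no  _     = proj₁ (fresh (classify C s) (labels C))

  remaining leaving : ℕ → Configuration → Configuration
  remaining i = filter (λ q → ¬? (item q ℕ.≟ i))
  leaving   i = filter (λ q → item q ℕ.≟ i)

  Mergeable : Configuration → Bin → Bin → Set (c Level.⊔ ℓ)
  Mergeable C b b′ = b ≢ b′ × tag b ≡ tag b′ × load b C < α × load b′ C < α

  mergeable? : ∀ C b → Decidable (Mergeable C b)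
  mergeable? C b b′ = ¬? (b ℕ.≟ b′) ×-dec (tag b ≟ᵗ tag b′) ×-dec (load b C <? α) ×-dec (load b′ C <? α)

  -- Only the bin that lost the item is tested, as no other load has dropped. If that bin has become
  -- empty, its merge is the empty list of moves.
  plan : ℕ → Configuration → List Migration
  plan i C with any? (λ b → any? (mergeable? (remaining i C) b) (labels (remaining i C))) (labels (leaving i C))
  ... | yes found with find found
  ...   | b , _ , found′ = moves b (proj₁ (find found′)) (remaining i C)
  plan i C | no _ = []

  -- An algorithm is given a history and no configuration, so it replays its own past decisions;
  -- `configuration≡state` confirms that the replay agrees with the actual run.
  state : History → Configuration
  state []                    = []
  state (arrives _ i s ∷ past) = placed i s (choose (state past) s) ∷ state past
  state (departs _ i ∷ past)   = applyMigrations (plan i (state past)) (remaining i (state past))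

  algorithm : Algorithm
  algorithm = record
    { place   = λ past _ _ s → choose (state past) s
    ; migrate = λ { (departs _ i ∷ past) → plan i (state past) ; _ → [] }
    }

  configuration≡state : ∀ h → configuration algorithm h ≡ state h
  configuration≡state []                     = refl
  configuration≡state (arrives _ i s ∷ past) = cong (placed i s (choose (state past) s) ∷_) (configuration≡state past)
  configuration≡state (departs _ i ∷ past)   =
    cong (λ C → applyMigrations (plan i (state past)) (remaining i C)) (configuration≡state past)

  level : Tag → ℕ
  level (tiny j)    = j
  level (regular k) = k

  -- Multiplication by powers of two avoids inverses; summed over a bin, these bounds compare a
  -- multiple of its load with its number of items.
  Fits : Tag → Carrier → Set ℓ
  Fits (tiny j)    s = pow2 (suc j) * s ≤ 1#
  Fits (regular k) s = pow2 k * s ≤ 1# × 1# ≤ pow2 (suc k) * s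

  scan-fits : ∀ f k {s} → pow2 k * s ≤ 1# → Fits (scan f k s) s
  scan-fits zero k {s} ≤1 with pow2 (suc k) * s ≤? 1#
  ... | yes ≤1′ = ≤1′
  ... | no  ≰1  = ≤1 , proj₁ (≰⇒> ≰1)
  scan-fits (suc f) k {s} ≤1 with pow2 (suc k) * s ≤? 1#
  ... | yes ≤1′ = scan-fits f (suc k) ≤1′
  ... | no  ≰1  = ≤1 , proj₁ (≰⇒> ≰1)

  scan-level : ∀ f k s → level (scan f k s) ℕ.≤ f ℕ.+ k
  scan-level zero k s with pow2 (suc k) * s ≤? 1#
  ... | yes _ = ℕ.≤-refl
  ... | no  _ = ℕ.≤-refl
  scan-level (suc f) k s with pow2 (suc k) * s ≤? 1#
  ... | yes _ = ℕ.≤-trans (scan-level f (suc k) s) (ℕ.≤-reflexive (ℕ.+-suc f k))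
  ... | no  _ = ℕ.m≤n+m k (suc f)

  scan-tiny : ∀ f k s {j} → scan f k s ≡ tiny j → j ≡ f ℕ.+ k
  scan-tiny zero k s eq with pow2 (suc k) * s ≤? 1# | eq
  ... | yes _ | refl = refl
  scan-tiny (suc f) k s eq with pow2 (suc k) * s ≤? 1# | eq
  ... | yes _ | eq′ = trans (scan-tiny f (suc k) s eq′) (ℕ.+-suc f k)

  classify-fits : ∀ C {s} → s ≤ 1# → Fits (classify C s) s
  classify-fits C {s} s≤1 = scan-fits ⌊log₂ suc (length C) ⌋ 0
    (≡-≤-trans (trans (cong (_* s) (+-identityʳ 1#)) (*-identityˡ s)) s≤1)

  data Choice (C : Configuration) (s : Carrier) (b : Bin) : Set ℓ where
    reuse : b ∈ labels C → Reusable C s b → Choice C s b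
    opened : b ∉ labels C → tag b ≡ classify C s → (∀ {x} → x ∈ labels C → ¬ Reusable C s x) → Choice C s b

  choose-spec : ∀ C s → Choice C s (choose C s)
  choose-spec C s with any? (reusable? C s) (labels C)
  ... | yes found with b , b∈ , ok ← find found = reuse b∈ ok
  ... | no  none with b , b∉ , ≡κ ← fresh (classify C s) (labels C) = opened b∉ ≡κ (λ x∈ ok → none (lose x∈ ok))

  choose-tag : ∀ C s → tag (choose C s) ≡ classify C s
  choose-tag C s with choose C s | choose-spec C s
  ... | _ | reuse _ (≡κ , _) = ≡κ
  ... | _ | opened _ ≡κ _     = ≡κ

  -- Indexed by the moves, so that matching on `plan-spec` also replaces `plan i C` in the goal.
  data Plan (i : ℕ) (C : Configuration) : List Migration → Set (c Level.⊔ ℓ) where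
    merge : ∀ {b b′} → b ∈ labels (leaving i C) → b′ ∈ labels (remaining i C) →
      Mergeable (remaining i C) b b′ → Plan i C (moves b b′ (remaining i C))
    keep : (∀ {b b′} → b ∈ labels (leaving i C) → b′ ∈ labels (remaining i C) →
      ¬ Mergeable (remaining i C) b b′) → Plan i C []

  plan-spec : ∀ i C → Plan i C (plan i C)
  plan-spec i C with any? (λ b → any? (mergeable? (remaining i C) b) (labels (remaining i C))) (labels (leaving i C))
  ... | yes found with find found
  ...   | b , b∈ , found′ with find found′
  ...     | b′ , b′∈ , ok = merge b∈ b′∈ ok
  plan-spec i C | no none = keep (λ b∈ b′∈ ok → none (lose b∈ (lose b′∈ ok)))

  record Proper (C : Configuration) : Set (c Level.⊔ ℓ) where
    field
      nonneg : NonNegative C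
      fits   : ∀ {q} → q ∈ C → Fits (tag (bin q)) (size q)
      items! : Unique (map item C)
      tiny!  : ∀ {b b′ j} → b ∈ labels C → b′ ∈ labels C → tag b ≡ tiny j → tag b′ ≡ tiny j → b ≡ b′
  open Proper

  OneLight : Configuration → Set (c Level.⊔ ℓ)
  OneLight C = ∀ {b b′} → b ∈ labels C → b′ ∈ labels C → tag b ≡ tag b′ → load b C < α → load b′ C < α → b ≡ b′

  Proper-[] : Proper []
  Proper-[] = record { nonneg = [] ; fits = λ () ; items! = [] ; tiny! = λ () }

  labels-filter⁻ : ∀ {p} {P : Pred Placed p} (P? : Decidable P) C {b} → b ∈ labels (filter P? C) → b ∈ labels C
  labels-filter⁻ P? C b∈ with q , q∈ , refl ← ∈-map⁻ bin b∈ = ∈-map⁺ bin (proj₁ (∈-filter⁻ P? q∈))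

  Proper-filter : ∀ {p} {P : Pred Placed p} (P? : Decidable P) {C} → Proper C → Proper (filter P? C)
  Proper-filter P? {C} ok = record
    { nonneg = All.filter⁺ P? (nonneg ok)
    ; fits   = λ q∈ → fits ok (proj₁ (∈-filter⁻ P? q∈))
    ; items! = unique-map-filter P? C (items! ok)
    ; tiny!  = λ b∈ b′∈ → tiny! ok (labels-filter⁻ P? C b∈) (labels-filter⁻ P? C b′∈)
    }

  Proper-relabel : ∀ {C b b′} → b ≢ b′ → tag b ≡ tag b′ → b′ ∈ labels C → Proper C → Proper (map (relabel b b′) C)
  Proper-relabel {C} {b} {b′} b≢b′ same b′∈ ok = record
    { nonneg = All.tabulate nonneg′
    ; fits   = fits′
    ; items! = subst Unique (sym (item-relabel b b′ C)) (items! ok)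
    ; tiny!  = λ x∈ y∈ → tiny! ok (proj₂ (labels-relabel⁻ C b≢b′ b′∈ x∈)) (proj₂ (labels-relabel⁻ C b≢b′ b′∈ y∈))
    }
    where
    nonneg′ : ∀ {q} → q ∈ map (relabel b b′) C → 0# ≤ size q
    nonneg′ q∈ with _ , q₀∈ , eq , _ ← ∈-relabel⁻ C q∈ = subst (0# ≤_) (sym eq) (All.lookup (nonneg ok) q₀∈)
    fits′ : ∀ {q} → q ∈ map (relabel b b′) C → Fits (tag (bin q)) (size q)
    fits′ q∈ with ∈-relabel⁻ C q∈
    ... | _ , q₀∈ , eq , inj₁ (refl , eq′) = subst₂ Fits (trans same (cong tag (sym eq′))) (sym eq) (fits ok q₀∈)
    ... | _ , q₀∈ , eq , inj₂ (_ , eq′)    = subst₂ Fits (cong tag (sym eq′)) (sym eq) (fits ok q₀∈)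

  -- All items concerned have size at most 2^-(j+1), and together with the new one there are at most
  -- 2^(j+1) of them.
  load-tiny : ∀ {C b j s} → Proper C → tag b ≡ tiny j → Fits (tiny j) s → suc (length C) ℕ.≤ 2 ^ suc j → load b C + s ≤ 1#
  load-tiny {C} {b} {j} {s} ok ≡tiny Ps≤1 few = *-cancelˡ-≤ (0<pow2 (suc j)) (begin
    P * (load b C + s)                     ≡⟨ distribˡ P _ s ⟩
    P * load b C + P * s                   ≤⟨ +-mono-≤ (sum≤*length size P (inBin b C) (All.tabulate each)) Ps≤1 ⟩
    fromℕ (length (inBin b C)) + 1#        ≡⟨ +-comm _ 1# ⟩
    fromℕ (suc (length (inBin b C)))       ≤⟨ fromℕ-mono-≤ (ℕ.≤-trans (s≤s (length-filter _ C)) few) ⟩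
    P                                      ≡⟨ *-identityʳ P ⟨
    P * 1#                                 ∎)
    where
    P = pow2 (suc j)
    each : ∀ {q} → q ∈ inBin b C → P * size q ≤ 1#
    each {q} q∈ with q∈C , refl ← ∈-inBin⁻ C q∈ = subst (λ κ → Fits κ (size q)) ≡tiny (fits ok q∈C)

  -- The tag cannot be tiny, since the item would then fit into `x` by `load-tiny`. In class 0 a
  -- single item of `x` already has size at least 1/2. In a higher class s ≤ 1/2, while `x` had no
  -- room for s.
  open⇒half : ∀ {C s x} → Proper C → 0# ≤ s → s ≤ 1# → (∀ {x} → x ∈ labels C → ¬ Reusable C s x) → x ∈ labels C →
    tag x ≡ classify C s → ∃[ k ] classify C s ≡ regular k × 1# ≤ load x C + load x C
  open⇒half {C} {s} {x} ok 0≤s s≤1 none x∈ ≡κ with classify C s in eq | classify-fits C s≤1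
  ... | tiny j | Ps≤1 = contradiction (≡κ , load-tiny ok ≡κ Ps≤1
      (subst (λ j → suc (length C) ℕ.≤ 2 ^ suc j) (sym (trans (scan-tiny ⌊log₂ suc (length C) ⌋ 0 s eq) (ℕ.+-identityʳ _)))
        (ℕ.<⇒≤ (n<2^[1+⌊log₂n⌋] (suc (length C)))))) (none x∈)
  ... | regular zero | _ with q , q∈ , refl ← ∈-map⁻ bin x∈ = 0 , refl , (begin
    1#                                  ≤⟨ proj₂ (subst (λ κ → Fits κ (size q)) ≡κ (fits ok q∈)) ⟩
    pow2 1 * size q                     ≡⟨ 2*x (size q) ⟩
    size q + size q                     ≤⟨ +-mono-≤ (size≤load (nonneg ok) q∈) (size≤load (nonneg ok) q∈) ⟩
    load (bin q) C + load (bin q) C     ∎)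
  ... | regular (suc k) | Ps≤1 , _ = suc k , refl , +-cancelʳ-≤ 1# (begin
    1# + 1#                             ≤⟨ +-mono-≤ 1≤l+s 1≤l+s ⟩
    l + s + (l + s)                     ≡⟨ solve 2 (λ l s → l :+ s :+ (l :+ s) := l :+ l :+ (s :+ s)) refl l s ⟩
    l + l + (s + s)                     ≡⟨ cong (l + l +_) (2*x s) ⟨
    l + l + fromℕ 2 * s                 ≤⟨ +-monoʳ-≤ (l + l) (*-monoʳ-≤ 0≤s (fromℕ-mono-≤ (ℕ.*-monoʳ-≤ 2 (ℕ.m^n>0 2 k)))) ⟩
    l + l + pow2 (suc k) * s            ≤⟨ +-monoʳ-≤ (l + l) Ps≤1 ⟩
    l + l + 1#                          ∎)
    where
    l = load x C
    1≤l+s : 1# ≤ l + s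
    1≤l+s = proj₁ (≰⇒> (λ fit → none x∈ (≡κ , fit)))

  ≤-<-trans : ∀ {x y z} → x ≤ y → y < z → x < z
  ≤-<-trans x≤y y<z = ≰⇒> (λ z≤x → <⇒≱ y<z (≤-trans z≤x x≤y))

  load-remaining : ∀ {b} i C → b ∉ labels (leaving i C) → load b (remaining i C) ≡ load b C
  load-remaining {b} i C b∉ = sym (trans (load-filter-split (λ q → item q ℕ.≟ i) C b)
    (trans (cong (load b (remaining i C) +_) (∉⇒load≡0 (leaving i C) b∉)) (+-identityʳ _)))

  -- Indices are unique in a configuration, so a departure lowers the load of one bin only.
  leaving-same : ∀ {C} i → Proper C → ∀ {b b′} → b ∈ labels (leaving i C) → b′ ∈ labels (leaving i C) → b ≡ b′
  leaving-same {C} i ok b∈ b′∈ with q , q∈ , refl ← ∈-map⁻ bin b∈ with q′ , q′∈ , refl ← ∈-map⁻ bin b′∈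
    with q∈C , ≡i ← ∈-filter⁻ (λ q → item q ℕ.≟ i) q∈ with q′∈C , ≡i′ ← ∈-filter⁻ (λ q → item q ℕ.≟ i) q′∈ =
    cong bin (unique-map-injective (items! ok) q∈C q′∈C (trans ≡i (sym ≡i′)))

  length-leaving : ∀ {C} i → Proper C → length (leaving i C) ℕ.≤ 1
  length-leaving {C} i ok = subst (ℕ._≤ 1) (length-map item (leaving i C))
    (unique-⊆⇒length≤ {ys = i ∷ []} (unique-map-filter _ C (items! ok)) ⊆[i])
    where
    ⊆[i] : ∀ {x} → x ∈ map item (leaving i C) → x ∈ i ∷ []
    ⊆[i] x∈ with q , q∈ , refl ← ∈-map⁻ item x∈ = here (proj₂ (∈-filter⁻ (λ q → item q ℕ.≟ i) {xs = C} q∈))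

  module _ (α+α<1 : α + α < 1#) where

    light⇒¬half : ∀ {x} → x < α → ¬ 1# ≤ x + x
    light⇒¬half (x≤α , _) 1≤ = <⇒≱ α+α<1 (≤-trans 1≤ (+-mono-≤ x≤α x≤α))

    arrival-Proper : ∀ {C s} i → Proper C → 0# ≤ s → s ≤ 1# → i ∉ map item C → Proper (placed i s (choose C s) ∷ C)
    arrival-Proper {C} {s} i ok 0≤s s≤1 i∉ with choose C s | choose-spec C s
    ... | b | choice = record
      { nonneg = 0≤s ∷ nonneg ok
      ; fits   = fits′ choice
      ; items! = All.tabulate (λ { j∈ refl → i∉ j∈ }) ∷ items! ok
      ; tiny!  = tiny!′ choice
      }
      where
      tag≡ : Choice C s b → tag b ≡ classify C s
      tag≡ (reuse _ (≡κ , _)) = ≡κ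
      tag≡ (opened _ ≡κ _)     = ≡κ
      fits′ : Choice C s b → ∀ {q} → q ∈ placed i s b ∷ C → Fits (tag (bin q)) (size q)
      fits′ choice (here refl) = subst (λ κ → Fits κ s) (sym (tag≡ choice)) (classify-fits C s≤1)
      fits′ choice (there q∈)  = fits ok q∈
      -- Opening a bin next to another of the same tag forces that tag to be regular, so no tiny
      -- level ever gets a second bin.
      clash : ∀ {x j} → (∀ {x} → x ∈ labels C → ¬ Reusable C s x) → tag b ≡ classify C s → x ∈ labels C →
        tag b ≡ tiny j → ¬ tag x ≡ tiny j
      clash none ≡κ x∈ b-tiny x-tiny
        with k , eq , _ ← open⇒half ok 0≤s s≤1 none x∈ (trans x-tiny (trans (sym b-tiny) ≡κ)) =
        contradiction (trans (sym b-tiny) (trans ≡κ eq)) λ ()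
      tiny!′ : Choice C s b → ∀ {x y j} → x ∈ b ∷ labels C → y ∈ b ∷ labels C → tag x ≡ tiny j → tag y ≡ tiny j → x ≡ y
      tiny!′ _ (here refl) (here refl) _ _ = refl
      tiny!′ _ (there x∈) (there y∈)       = tiny! ok x∈ y∈
      tiny!′ (reuse b∈ _) (here refl) (there y∈) = tiny! ok b∈ y∈
      tiny!′ (reuse b∈ _) (there x∈) (here refl) = tiny! ok x∈ b∈
      tiny!′ (opened _ ≡κ none) (here refl) (there y∈) p q = contradiction q (clash none ≡κ y∈ p)
      tiny!′ (opened _ ≡κ none) (there x∈) (here refl) p q = contradiction p (clash none ≡κ x∈ q)

    -- Loads only grow, so a new pair of light bins would involve a newly opened bin; its companions
    -- are half full by `open⇒half`, hence not light.
    arrival-OneLight : ∀ {C s} i → Proper C → OneLight C → 0# ≤ s → s ≤ 1# → OneLight (placed i s (choose C s) ∷ C)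
    arrival-OneLight {C} {s} i ok light! 0≤s s≤1 with choose C s | choose-spec C s
    ... | b | choice = light!′ choice
      where
      shrink : ∀ {x} → load x (placed i s b ∷ C) < α → load x C < α
      shrink {x} = ≤-<-trans (load-mono-∷ {placed i s b} C x 0≤s)
      clash : ∀ {x} → (∀ {x} → x ∈ labels C → ¬ Reusable C s x) → tag b ≡ classify C s → x ∈ labels C →
        tag x ≡ tag b → ¬ load x (placed i s b ∷ C) < α
      clash {x} none ≡κ x∈ same x<α
        with _ , _ , half ← open⇒half ok 0≤s s≤1 none x∈ (trans same ≡κ) = light⇒¬half (shrink x<α) half
      light!′ : Choice C s b → OneLight (placed i s b ∷ C)
      light!′ _ (here refl) (here refl) _ _ _ = refl
      light!′ _ (there x∈) (there y∈) same p q = light! x∈ y∈ same (shrink p) (shrink q)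
      light!′ (reuse b∈ _) (here refl) (there y∈) same p q = light! b∈ y∈ same (shrink p) (shrink q)
      light!′ (reuse b∈ _) (there x∈) (here refl) same p q = light! x∈ b∈ same (shrink p) (shrink q)
      light!′ (opened _ ≡κ none) (here refl) (there y∈) same p q = contradiction q (clash none ≡κ y∈ (sym same))
      light!′ (opened _ ≡κ none) (there x∈) (here refl) same p q = contradiction p (clash none ≡κ x∈ same)

    choose-legal : ∀ C {s} → s ≤ 1# → load (choose C s) C + s ≤ 1#
    choose-legal C {s} s≤1 with choose C s | choose-spec C s
    ... | _ | reuse _ (_ , fit) = fit
    ... | _ | opened b∉ _ _      = ≡-≤-trans (trans (cong (_+ s) (∉⇒load≡0 C b∉)) (+-identityˡ s)) s≤1

    merged : ∀ {C b b′} → Proper C → Mergeable C b b′ →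
      LegalMigrations (moves b b′ C) C × applyMigrations (moves b b′ C) C ≡ map (relabel b b′) C
    merged {C} ok (b≢b′ , _ , (b≤α , _) , (b′≤α , _)) =
      moves-merge C b≢b′ (nonneg ok) (items! ok) (≤-trans (+-mono-≤ b≤α b′≤α) (proj₁ α+α<1))

    plan-legal : ∀ {C} i → Proper C → LegalMigrations (plan i C) (remaining i C)
    plan-legal {C} i ok with plan i C | plan-spec i C
    ... | _ | merge _ _ mergeable = proj₁ (merged (Proper-filter _ ok) mergeable)
    ... | _ | keep _              = tt

    departure-Proper : ∀ {C} i → Proper C → Proper (applyMigrations (plan i C) (remaining i C))
    departure-Proper {C} i ok with plan i C | plan-spec i C
    ... | _ | keep _ = Proper-filter _ ok
    ... | _ | merge _ b′∈ mergeable@(b≢b′ , same , _) = subst Proper (sym (proj₂ (merged (Proper-filter _ ok) mergeable)))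
      (Proper-relabel b≢b′ same b′∈ (Proper-filter _ ok))

    -- Without a merge, a light pair that includes the bin just left would have been found, and any
    -- other pair was light before. After a merge that bin is gone, and every remaining load is at
    -- least what it was before the departure.
    departure-OneLight : ∀ {C} i → Proper C → OneLight C → OneLight (applyMigrations (plan i C) (remaining i C))
    departure-OneLight {C} i ok light! with plan i C | plan-spec i C
    ... | _ | keep none = light!′
      where
      light!′ : OneLight (remaining i C)
      light!′ {x} {y} x∈ y∈ same p q with x ℕ.≟ y | _∈?_ ℕ._≟_ x (labels (leaving i C)) | _∈?_ ℕ._≟_ y (labels (leaving i C))
      ... | yes x≡y | _      | _      = x≡y
      ... | no  x≢y | yes x∈′ | _     = contradiction (x≢y , same , p , q) (none x∈′ y∈)
      ... | no  x≢y | no _   | yes y∈′ = contradiction ((λ y≡x → x≢y (sym y≡x)) , sym same , q , p) (none y∈′ x∈)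
      ... | no  x≢y | no x∉  | no y∉  = light! (labels-filter⁻ _ C x∈) (labels-filter⁻ _ C y∈) same
        (subst (_< α) (load-remaining i C x∉) p) (subst (_< α) (load-remaining i C y∉) q)
    ... | _ | merge {b} {b′} b∈ b′∈ mergeable@(b≢b′ , same , _) =
      subst OneLight (sym (proj₂ (merged (Proper-filter _ ok) mergeable))) light!′
      where
      before : ∀ {x} → x ≢ b → load x (map (relabel b b′) (remaining i C)) < α → load x C < α
      before x≢b p = subst (_< α) (load-remaining i C (λ x∈ → x≢b (leaving-same i ok x∈ b∈)))
        (≤-<-trans (load-relabel (remaining i C) (nonneg (Proper-filter _ ok)) x≢b) p)
      light!′ : OneLight (map (relabel b b′) (remaining i C))
      light!′ x∈ y∈ same p q with labels-relabel⁻ _ b≢b′ b′∈ x∈ | labels-relabel⁻ _ b≢b′ b′∈ y∈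
      ... | x≢b , x∈C | y≢b , y∈C = light! (labels-filter⁻ _ C x∈C) (labels-filter⁻ _ C y∈C) same (before x≢b p) (before y≢b q)

    -- Departures open no bins, so levels need to be bounded at arrivals only.
    departure-labels : ∀ {C} i → Proper C → ∀ {x} → x ∈ labels (applyMigrations (plan i C) (remaining i C)) → x ∈ labels C
    departure-labels {C} i ok x∈ with plan i C | plan-spec i C
    ... | _ | keep _ = labels-filter⁻ _ C x∈
    ... | _ | merge _ b′∈ mergeable@(b≢b′ , _) = labels-filter⁻ _ C (proj₂ (labels-relabel⁻ _ b≢b′ b′∈
      (subst (λ D → _ ∈ labels D) (proj₂ (merged (Proper-filter _ ok) mergeable)) x∈)))

-- Histories and the items alive in them

module Histories {c ℓ} (F : OrderedField c ℓ) where
  open OrderedField F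
  open BinPacking F
  open Placed

  arrivedItem departedItem : Observation → Maybe ℕ
  arrivedItem (arrives _ i _) = just i
  arrivedItem (departs _ _)   = nothing
  departedItem (arrives _ _ _) = nothing
  departedItem (departs _ i)   = just i

  arrivals departures : History → List ℕ
  arrivals   = mapMaybe arrivedItem
  departures = mapMaybe departedItem

  UnitSize : Observation → Set ℓ
  UnitSize (arrives _ _ s) = 0# ≤ s × s ≤ 1#
  UnitSize (departs _ _)   = ⊤

  Valid : History → Set (c Level.⊔ ℓ)
  Valid h = Unique (arrivals h) × All UnitSize h

  data Alive : History → ℕ → Carrier → Set c where
    now   : ∀ {past t i s} → Alive (arrives t i s ∷ past) i s
    later : ∀ {past o i s} → departedItem o ≢ just i → Alive past i s → Alive (o ∷ past) i s

  Alive⇒arrival : ∀ {h i s} → Alive h i s → i ∈ arrivals h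
  Alive⇒arrival now = here refl
  Alive⇒arrival (later {o = arrives _ _ _} _ alive) = there (Alive⇒arrival alive)
  Alive⇒arrival (later {o = departs _ _}   _ alive) = Alive⇒arrival alive

  ∈-applyMigrations⁻ : ∀ ms C {q} → q ∈ applyMigrations ms C → ∃[ q₀ ] q₀ ∈ C × item q ≡ item q₀ × size q ≡ size q₀
  ∈-applyMigrations⁻ []       C q∈ = _ , q∈ , refl , refl
  ∈-applyMigrations⁻ (m ∷ ms) C q∈ with ∈-applyMigrations⁻ ms _ q∈
  ... | q₁ , q₁∈ , item≡ , size≡ with one C q₁∈
    where
    one : ∀ C {q} → q ∈ applyMigration m C → ∃[ q₀ ] q₀ ∈ C × item q ≡ item q₀ × size q ≡ size q₀
    one (q ∷ C) q∈ with item q ℕ.≟ Migration.item m | q∈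
    ... | yes _ | here refl = q , here refl , refl , refl
    ... | no  _ | here refl = q , here refl , refl , refl
    ... | _     | there q∈C with q₀ , q₀∈ , eqs ← one C q∈C = q₀ , there q₀∈ , eqs
  ... | q₀ , q₀∈ , item≡′ , size≡′ = q₀ , q₀∈ , trans item≡ item≡′ , trans size≡ size≡′

  module _ (A : Algorithm) where
    open Algorithm A

    configuration-alive : ∀ h {q} → q ∈ configuration A h → Alive h (item q) (size q)
    configuration-alive (o ∷ past) q∈ with ∈-applyMigrations⁻ (migrate (o ∷ past)) _ q∈
    ... | q₀ , q₀∈ , item≡ , size≡ = subst₂ (Alive (o ∷ past)) (sym item≡) (sym size≡) (observed o q₀∈)
      where
      observed : ∀ o {q} → q ∈ observe A o past (configuration A past) → Alive (o ∷ past) (item q) (size q)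
      observed (arrives _ _ _) (here refl) = now
      observed (arrives _ _ _) (there q∈)  = later (λ ()) (configuration-alive past q∈)
      observed (departs _ i)   q∈ with q∈C , ≢i ← ∈-filter⁻ (λ q → ¬? (item q ℕ.≟ i)) q∈ =
        later (λ { refl → ≢i refl }) (configuration-alive past q∈C)

-- Amortised count of the migrations

record Admissible {c ℓ} (F : OrderedField c ℓ) (α δ : OrderedField.Carrier F) : Set (c Level.⊔ ℓ) where
  open OrderedField F
  field
    0<α    : 0# < α
    0<δ    : 0# < δ
    δ+2α≡1 : δ + (α + α) ≡ 1#
    α+α<1  : α + α < 1#

  0≤α : 0# ≤ α
  0≤α = proj₁ 0<α

  0≤δ : 0# ≤ δ
  0≤δ = proj₁ 0<δ

module Accounting {c ℓ} {F : OrderedField c ℓ} {α δ : OrderedField.Carrier F} (admissible : Admissible F α δ) where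
  open OrderedField F
  open Admissible admissible
  open BinPacking F
  open OrderedFieldProperties F
  open Configurations F
  open FirstFitByClass F α
  open Histories F
  open CommutativeRing commutativeRing using (+-comm; +-identityˡ; *-identityˡ; *-identityʳ; distribˡ; zeroʳ)
  open Placed
  open Proper

  credit : Bin → Configuration → ℕ
  credit b L = length (inBin b L)

  -- l ≥ 1/2 − d·2⁻ᵏ, multiplied by 2ᵏ⁺¹: what is missing from half a bin is covered by d departures of class k.
  record Enough (k : ℕ) (l : Carrier) (d : ℕ) : Set ℓ where
    constructor enough
    field bound : pow2 k ≤ (pow2 k * l + pow2 k * l) + (fromℕ d + fromℕ d)

  Enough-mono : ∀ k {l l′ d d′} → l ≤ l′ → d ℕ.≤ d′ → Enough k l d → Enough k l′ d′
  Enough-mono k l≤l′ d≤d′ (enough bound) = enough (≤-trans bound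
    (+-mono-≤ (+-mono-≤ (*-monoˡ-≤ (proj₁ (0<pow2 k)) l≤l′) (*-monoˡ-≤ (proj₁ (0<pow2 k)) l≤l′))
              (+-mono-≤ (fromℕ-mono-≤ d≤d′) (fromℕ-mono-≤ d≤d′))))

  half⇒Enough : ∀ k {l} d → 1# ≤ l + l → Enough k l d
  half⇒Enough k {l} d 1≤ = enough (begin
    pow2 k                                              ≡⟨ *-identityʳ _ ⟨
    pow2 k * 1#                                         ≤⟨ *-monoˡ-≤ (proj₁ (0<pow2 k)) 1≤ ⟩
    pow2 k * (l + l)                                    ≡⟨ distribˡ _ l l ⟩
    pow2 k * l + pow2 k * l                             ≤⟨ x≤x+y (0≤+ (0≤fromℕ d) (0≤fromℕ d)) ⟩
    pow2 k * l + pow2 k * l + (fromℕ d + fromℕ d)       ∎)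

  4α : Carrier
  4α = (α + α) + (α + α)

  0≤4α : 0# ≤ 4α
  0≤4α = 0≤+ (0≤+ 0≤α 0≤α) (0≤+ 0≤α 0≤α)

  Funded : (ℕ → Bin) → Configuration → Configuration → Set ℓ
  Funded e L C = ∀ {b k} → b ∈ labels C → tag b ≡ regular k → b ≢ e k → Enough k (load b C) (credit b L)

  -- departed holds the departures not yet charged for a migration; exempt k is the one
  -- bin of class k that need not have been half full since it was opened.
  record Credits (M D : ℕ) (C : Configuration) : Set (c Level.⊔ ℓ) where
    field
      exempt   : ℕ → Bin
      departed : Configuration
      funded   : Funded exempt departed C
      budget   : δ * fromℕ M + 4α * fromℕ (length departed) ≤ 4α * fromℕ D

  -- Passes the exemption of the class of `b` to `b`; a tiny `b` has no such class and changes
  -- nothing.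
  exempting : Bin → (ℕ → Bin) → ℕ → Bin
  exempting b e k with tag b ≟ᵗ regular k
  ... | yes _ = b
  ... | no  _ = e k

  exempting-≢ : ∀ b e {x k} → tag x ≡ regular k → x ≢ exempting b e k → x ≢ b × (tag b ≡ regular k ⊎ x ≢ e k)
  exempting-≢ b e {x} {k} x-regular x≢ with tag b ≟ᵗ regular k
  ... | yes eq = x≢ , inj₁ eq
  ... | no ¬eq = (λ { refl → ¬eq x-regular }) , inj₂ x≢

  arrival-Credits : ∀ {C M D s} i → Proper C → 0# ≤ s → s ≤ 1# → Credits M D C → Credits M D (placed i s (choose C s) ∷ C)
  arrival-Credits {C} {M} {D} {s} i ok 0≤s s≤1 credits with choose C s | choose-spec C s
  ... | b | choice = go choice
    where
    open Credits credits
    grow : ∀ {x} k d → Enough k (load x C) d → Enough k (load x (placed i s b ∷ C)) d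
    grow {x} k d = Enough-mono k (load-mono-∷ {placed i s b} C x 0≤s) ℕ.≤-refl
    go : Choice C s b → Credits M D (placed i s b ∷ C)
    go (reuse b∈ _) = record { exempt = exempt ; departed = departed ; funded = funded′ ; budget = budget }
      where
      funded′ : Funded exempt departed (placed i s b ∷ C)
      funded′ {k = k} (here refl) r ≢e = grow k _ (funded b∈ r ≢e)
      funded′ {k = k} (there x∈)  r ≢e = grow k _ (funded x∈ r ≢e)
    go (opened b∉ ≡κ none) = record { exempt = exempting b exempt ; departed = departed ; funded = funded′ ; budget = budget }
      where
      funded′ : Funded (exempting b exempt) departed (placed i s b ∷ C)
      funded′ x∈ r ≢e with exempting-≢ b exempt r ≢e
      funded′ (here refl) r ≢e | ≢b , _ = contradiction refl ≢b
      funded′ {x} {k} (there x∈) r ≢e | _ , inj₂ x≢e = grow k _ (funded x∈ r x≢e)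
      -- The bin exempt so far in this class must now be funded as well. Like every companion of a
      -- newly opened bin it is half full, which needs no departures at all.
      funded′ {x} {k} (there x∈) r ≢e | _ , inj₁ b-regular
        with _ , _ , half ← open⇒half ok 0≤s s≤1 none x∈ (trans r (trans (sym b-regular) ≡κ)) =
        grow k _ (half⇒Enough k (credit x departed) half)

  credit-++ : ∀ b L L′ → credit b (L ++ L′) ≡ credit b L ℕ.+ credit b L′
  credit-++ b L L′ = trans (cong length (filter-++ _ L L′)) (length-++ (inBin b L))

  notIn : Bin → Configuration → Configuration
  notIn b = filter (λ q → ¬? (bin q ℕ.≟ b))

  credit-notIn : ∀ {x} b L → x ≢ b → credit x L ℕ.≤ credit x (notIn b L)
  credit-notIn b L x≢b = length-filter-filter _ _ (λ { refl ≡b → x≢b ≡b }) L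

  -- An item of class k has size at most 2^-k, so its departure lowers 2^k times the load by at most
  -- 1, which its own credit makes up for.
  departure-Enough : ∀ {C b k} i d → Proper C → tag b ≡ regular k → Enough k (load b C) d →
    Enough k (load b (remaining i C)) (credit b (leaving i C) ℕ.+ d)
  departure-Enough {C} {b} {k} i d ok r (enough bound) = enough (begin
    P                                                                     ≤⟨ bound ⟩
    P * load b C + P * load b C + (fromℕ d + fromℕ d)                     ≡⟨ cong (λ l → P * l + P * l + (fromℕ d + fromℕ d)) (load-filter-split _ C b) ⟩
    P * (l′ + g) + P * (l′ + g) + (fromℕ d + fromℕ d)                     ≡⟨ solve 4 (λ P l g d → P :* (l :+ g) :+ P :* (l :+ g) :+ (d :+ d) := P :* l :+ P :* l :+ (P :* g :+ d :+ (P :* g :+ d))) refl P l′ g (fromℕ d) ⟩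
    P * l′ + P * l′ + (P * g + fromℕ d + (P * g + fromℕ d))               ≤⟨ +-monoʳ-≤ _ (+-mono-≤ (+-monoˡ-≤ _ gone) (+-monoˡ-≤ _ gone)) ⟩
    P * l′ + P * l′ + (fromℕ m + fromℕ d + (fromℕ m + fromℕ d))           ≡⟨ cong (λ n → P * l′ + P * l′ + (n + n)) (fromℕ-+ m d) ⟨
    P * l′ + P * l′ + (fromℕ (m ℕ.+ d) + fromℕ (m ℕ.+ d))                 ∎)
    where
    P = pow2 k
    l′ = load b (remaining i C)
    g = load b (leaving i C)
    m = credit b (leaving i C)
    each : ∀ {q} → q ∈ inBin b (leaving i C) → P * size q ≤ 1#
    each {q} q∈ with q∈L , refl ← ∈-inBin⁻ (leaving i C) q∈ =
      proj₁ (subst (λ κ → Fits κ (size q)) r (fits ok (proj₁ (∈-filter⁻ (λ q → item q ℕ.≟ i) q∈L))))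
    gone : P * g ≤ fromℕ m
    gone = sum≤*length size P (inBin b (leaving i C)) (All.tabulate each)

  -- A light bin of class k holds at most α·2ᵏ⁺¹ items, and one that was half full before
  -- has seen at least (1/2 − α)·2ᵏ departures since.
  spend : ∀ {C b k v} d → Proper C → tag b ≡ regular k → load b C ≤ α → load v C ≤ α → Enough k (load v C) d →
    δ * fromℕ (length (inBin b C)) ≤ 4α * fromℕ d
  spend {C} {b} {k} {v} d ok r b≤α v≤α (enough bound) = begin
    δ * fromℕ m                            ≤⟨ *-monoˡ-≤ 0≤δ few ⟩
    δ * ((P + P) * α)                      ≡⟨ solve 3 (λ δ P α → δ :* ((P :+ P) :* α) := (α :+ α) :* (P :* δ)) refl δ P α ⟩
    (α + α) * (P * δ)                      ≤⟨ *-monoˡ-≤ (0≤+ 0≤α 0≤α) paid ⟩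
    (α + α) * (fromℕ d + fromℕ d)          ≡⟨ solve 2 (λ α d → (α :+ α) :* (d :+ d) := ((α :+ α) :+ (α :+ α)) :* d) refl α (fromℕ d) ⟩
    4α * fromℕ d                           ∎
    where
    P = pow2 k
    m = length (inBin b C)
    each : ∀ {q} → q ∈ inBin b C → 1# ≤ pow2 (suc k) * size q
    each {q} q∈ with q∈C , refl ← ∈-inBin⁻ C q∈ = proj₂ (subst (λ κ → Fits κ (size q)) r (fits ok q∈C))
    few : fromℕ m ≤ (P + P) * α
    few = begin
      fromℕ m                     ≡⟨ *-identityˡ _ ⟨
      1# * fromℕ m                ≤⟨ length*≤sum size (pow2 (suc k)) (inBin b C) (All.tabulate each) ⟩
      pow2 (suc k) * load b C     ≤⟨ *-monoˡ-≤ (proj₁ (0<pow2 (suc k))) b≤α ⟩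
      pow2 (suc k) * α            ≡⟨ cong (_* α) (pow2-suc k) ⟩
      (P + P) * α                 ∎
    paid : P * δ ≤ fromℕ d + fromℕ d
    paid = +-cancelʳ-≤ (P * α + P * α) (begin
      P * δ + (P * α + P * α)                                  ≡⟨ solve 3 (λ P δ α → P :* δ :+ (P :* α :+ P :* α) := P :* (δ :+ (α :+ α))) refl P δ α ⟩
      P * (δ + (α + α))                                        ≡⟨ trans (cong (P *_) δ+2α≡1) (*-identityʳ P) ⟩
      P                                                        ≤⟨ bound ⟩
      P * load v C + P * load v C + (fromℕ d + fromℕ d)        ≤⟨ +-monoˡ-≤ _ (+-mono-≤ (*-monoˡ-≤ (proj₁ (0<pow2 k)) v≤α) (*-monoˡ-≤ (proj₁ (0<pow2 k)) v≤α)) ⟩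
      P * α + P * α + (fromℕ d + fromℕ d)                      ≡⟨ +-comm _ _ ⟩
      fromℕ d + fromℕ d + (P * α + P * α)                      ∎)

  -- A departure raises the right side by 4α and adds at most one credit; `charge` then trades the
  -- spent credits for the m new migrations.
  departure-budget : ∀ {C M D L} i m spent kept → Proper C → δ * fromℕ M + 4α * fromℕ (length L) ≤ 4α * fromℕ D →
    length (leaving i C ++ L) ≡ spent ℕ.+ kept → δ * fromℕ m ≤ 4α * fromℕ spent →
    δ * fromℕ (m ℕ.+ M) + 4α * fromℕ kept ≤ 4α * fromℕ (suc D)
  departure-budget {C} {M} {D} {L} i m spent kept ok budget split charge = begin
    δ * fromℕ (m ℕ.+ M) + 4α * fromℕ kept                         ≡⟨ cong (λ n → δ * n + 4α * fromℕ kept) (fromℕ-+ m M) ⟩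
    δ * (fromℕ m + fromℕ M) + 4α * fromℕ kept                     ≡⟨ solve 5 (λ δ m M a k → δ :* (m :+ M) :+ a :* k := δ :* m :+ (δ :* M :+ a :* k)) refl δ (fromℕ m) (fromℕ M) 4α (fromℕ kept) ⟩
    δ * fromℕ m + (δ * fromℕ M + 4α * fromℕ kept)                 ≤⟨ +-monoˡ-≤ _ charge ⟩
    4α * fromℕ spent + (δ * fromℕ M + 4α * fromℕ kept)            ≡⟨ solve 4 (λ a s x k → a :* s :+ (x :+ a :* k) := x :+ a :* (s :+ k)) refl 4α (fromℕ spent) (δ * fromℕ M) (fromℕ kept) ⟩
    δ * fromℕ M + 4α * (fromℕ spent + fromℕ kept)                 ≡⟨ cong (λ n → δ * fromℕ M + 4α * n) (trans (cong fromℕ split) (fromℕ-+ spent kept)) ⟨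
    δ * fromℕ M + 4α * fromℕ (length (leaving i C ++ L))          ≤⟨ +-monoʳ-≤ _ (*-monoˡ-≤ 0≤4α (fromℕ-mono-≤ one-more)) ⟩
    δ * fromℕ M + 4α * fromℕ (suc (length L))                     ≡⟨ solve 3 (λ x a l → x :+ a :* (con 1 :+ l) := x :+ a :* l :+ a) refl (δ * fromℕ M) 4α (fromℕ (length L)) ⟩
    δ * fromℕ M + 4α * fromℕ (length L) + 4α                      ≤⟨ +-monoˡ-≤ 4α budget ⟩
    4α * fromℕ D + 4α                                             ≡⟨ solve 2 (λ a d → a :* d :+ a := a :* (con 1 :+ d)) refl 4α (fromℕ D) ⟩
    4α * fromℕ (suc D)                                            ∎
    where
    one-more : length (leaving i C ++ L) ℕ.≤ suc (length L)
    one-more = ℕ.≤-trans (ℕ.≤-reflexive (length-++ (leaving i C))) (ℕ.+-monoˡ-≤ (length L) (length-leaving i ok))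

  -- In a merge of `b` into `b′` the credits of `b` pay unless `b` is exempt. Otherwise those of
  -- `b′` pay, and `b′` becomes exempt in place of `b`, which no longer exists.
  departure-Credits : ∀ {C M D} i → Proper C → Credits M D C →
    Credits (length (plan i C) ℕ.+ M) (suc D) (applyMigrations (plan i C) (remaining i C))
  departure-Credits {C} {M} {D} i ok credits with plan i C | plan-spec i C
  ... | _ | choice = go choice
    where
    open Credits credits
    C′ = remaining i C
    L′ = leaving i C ++ departed
    ok′ : Proper C′
    ok′ = Proper-filter _ ok
    funded⁺ : ∀ {x k} → x ∈ labels C → tag x ≡ regular k → x ≢ exempt k → Enough k (load x C′) (credit x L′)
    funded⁺ {x} {k} x∈ r x≢e = subst (Enough k (load x C′)) (sym (credit-++ x (leaving i C) departed))
      (departure-Enough i _ ok r (funded x∈ r x≢e))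
    go : ∀ {ms} → Plan i C ms → Credits (length ms ℕ.+ M) (suc D) (applyMigrations ms C′)
    go (keep _) = record
      { exempt   = exempt
      ; departed = L′
      ; funded   = λ x∈ → funded⁺ (labels-filter⁻ _ C x∈)
      ; budget   = departure-budget {M = M} {D} {departed} i 0 0 (length L′) ok budget refl
                     (≤-reflexive (trans (zeroʳ δ) (sym (zeroʳ 4α))))
      }
    go (merge {b} {b′} b∈ b′∈ mergeable@(b≢b′ , same , (b≤α , _) , (b′≤α , _))) =
      subst (Credits _ (suc D)) (sym (proj₂ (merged α+α<1 ok′ mergeable))) (byTag (tag b) refl)
      where
      b∈C  = labels-filter⁻ _ C b∈
      b′∈C = labels-filter⁻ _ C b′∈
      C″ = map (relabel b b′) C′
      -- The moved items are always those of `b`, but `v`, the bin whose credits are spent, can be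
      -- either of the two: both are light and of the same class.
      pay : ∀ {k} v → tag b ≡ regular k → v ∈ labels C → tag v ≡ regular k → v ≢ exempt k → load v C′ ≤ α →
        δ * fromℕ (length (moves b b′ C′) ℕ.+ M) + 4α * fromℕ (length (notIn v L′)) ≤ 4α * fromℕ (suc D)
      pay v b-tag v∈ r v≢e v≤α = departure-budget {M = M} {D} {departed} i (length (moves b b′ C′)) (credit v L′) (length (notIn v L′)) ok budget
        (length-filter-split (λ q → bin q ℕ.≟ v) L′)
        (≡-≤-trans (cong (λ n → δ * fromℕ n) (length-map _ (inBin b C′))) (spend (credit v L′) ok′ b-tag b≤α v≤α (funded⁺ v∈ r v≢e)))
      rest : ∀ v {x k′} → x ≢ v → x ∈ labels C″ → tag x ≡ regular k′ → x ≢ exempt k′ → Enough k′ (load x C″) (credit x (notIn v L′))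
      rest v {k′ = k′} x≢v x∈ r x≢e with x≢b , x∈C′ ← labels-relabel⁻ C′ b≢b′ b′∈ x∈ =
        Enough-mono k′ (load-relabel C′ (nonneg ok′) x≢b) (credit-notIn v L′ x≢v) (funded⁺ (labels-filter⁻ _ C x∈C′) r x≢e)
      byTag : ∀ κ → tag b ≡ κ → Credits (length (moves b b′ C′) ℕ.+ M) (suc D) C″
      -- Each tiny level has a single bin, so tiny bins have no partner for a merge.
      byTag (tiny _) b-tag = contradiction (tiny! ok b∈C b′∈C b-tag (trans (sym same) b-tag)) b≢b′
      byTag (regular k) b-tag with exempt k ℕ.≟ b
      ... | no e≢b = record
        { exempt   = exempt
        ; departed = notIn b L′
        ; funded   = λ x∈ → rest b (proj₁ (labels-relabel⁻ C′ b≢b′ b′∈ x∈)) x∈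
        ; budget   = pay b b-tag b∈C b-tag (λ b≡e → e≢b (sym b≡e)) b≤α
        }
      ... | yes e≡b = record
        { exempt   = exempting b′ exempt
        ; departed = notIn b′ L′
        ; funded   = funded′
        ; budget   = pay b′ b-tag b′∈C (trans (sym same) b-tag) (λ b′≡e → b≢b′ (sym (trans b′≡e e≡b))) b′≤α
        }
        where
        funded′ : Funded (exempting b′ exempt) (notIn b′ L′) C″
        funded′ x∈ r x≢e with exempting-≢ b′ exempt r x≢e
        ... | x≢b′ , inj₂ x≢e′ = rest b′ x≢b′ x∈ r x≢e′
        -- The exemption is taken from `b`, and `x` differs from `b` because the merge has emptied
        -- `b`.
        ... | x≢b′ , inj₁ b′-tag with refl ← trans (sym b-tag) (trans same b′-tag) =
          rest b′ x≢b′ x∈ r (λ x≡e → proj₁ (labels-relabel⁻ C′ b≢b′ b′∈ x∈) (trans x≡e e≡b))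

  record Invariant (h : History) : Set (c Level.⊔ ℓ) where
    field
      proper   : Proper (state h)
      oneLight : OneLight (state h)
      credits  : Credits (migrations algorithm h) (length (departures h)) (state h)
      legal    : Legal algorithm h
  open Invariant

  -- Stated for all valid histories, so that one induction serves both the full history and the
  -- history at each time.
  invariant : ∀ h → Valid h → Invariant h
  invariant [] _ = record
    { proper   = Proper-[]
    ; oneLight = λ ()
    -- Label 0 is an arbitrary default, since no bin is open yet.
    ; credits  = record { exempt = λ _ → 0 ; departed = [] ; funded = λ () ; budget = ≤-reflexive (trans (cong (_+ 4α * 0#) (zeroʳ δ)) (+-identityˡ _)) }
    ; legal    = tt
    }
  invariant (arrives t i s ∷ past) (i∉ ∷ arrivals! , (0≤s , s≤1) ∷ unit) with invariant past (arrivals! , unit)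
  ... | inv = record
    { proper   = arrival-Proper α+α<1 i (proper inv) 0≤s s≤1 new
    ; oneLight = arrival-OneLight α+α<1 i (proper inv) (oneLight inv) 0≤s s≤1
    ; credits  = arrival-Credits i (proper inv) 0≤s s≤1 (credits inv)
    ; legal    = legal inv , subst (λ C → load (choose (state past) s) C + s ≤ 1#) (sym (configuration≡state past))
        (choose-legal α+α<1 (state past) s≤1) , tt
    }
    where
    new : i ∉ map item (state past)
    new i∈ with q , q∈ , refl ← ∈-map⁻ item i∈ = All.lookup i∉
      (Alive⇒arrival (configuration-alive algorithm past (subst (q ∈_) (sym (configuration≡state past)) q∈))) refl
  invariant (departs t i ∷ past) (arrivals! , _ ∷ unit) with invariant past (arrivals! , unit)
  ... | inv = record
    { proper   = departure-Proper α+α<1 i (proper inv)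
    ; oneLight = departure-OneLight α+α<1 i (proper inv) (oneLight inv)
    ; credits  = departure-Credits i (proper inv) (credits inv)
    ; legal    = legal inv , tt , subst (λ C → LegalMigrations (plan i (state past)) (remaining i C)) (sym (configuration≡state past))
        (plan-legal α+α<1 i (proper inv))
    }

-- Timelines of instances and the items present

module Instances {c ℓ} (F : OrderedField c ℓ) {n : ℕ} (I : BinPacking.Instance F n) where
  open OrderedField F
  open BinPacking F
  open OrderedFieldProperties F
  open Histories F
  open Instance I
  open DecTotalOrder observationOrder using () renaming (_≤_ to _≤ᵒ_; totalOrder to observationTotalOrder)
  open CommutativeRing commutativeRing using (+-identityˡ; +-comm)

  arr dep : Fin n → Observation
  arr j = arrives (arrival j) (toℕ j) (size j)
  dep j = departs (departure j) (toℕ j)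

  events : List Observation
  events = map arr (allFin n) ++ map dep (allFin n)

  timeline↭events : timeline I ↭ events
  timeline↭events = Sort.sort-↭ observationOrder events

  fullHistory↭events : fullHistory I ↭ events
  fullHistory↭events = ↭-trans (↭-reverse (timeline I)) timeline↭events

  arrivals-events : arrivals events ≡ map toℕ (allFin n)
  arrivals-events = trans (mapMaybe-++ arrivedItem (map arr (allFin n)) _)
    (trans (cong₂ _++_ (arrs (allFin n)) (deps (allFin n))) (++-identityʳ _))
    where
    arrs : ∀ js → arrivals (map arr js) ≡ map toℕ js
    arrs []       = refl
    arrs (j ∷ js) = cong (toℕ j ∷_) (arrs js)
    deps : ∀ js → arrivals (map dep js) ≡ []
    deps []       = refl
    deps (_ ∷ js) = deps js

  length-departures : length (departures (fullHistory I)) ≡ n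
  length-departures = trans (↭-length (mapMaybe-↭ departedItem fullHistory↭events))
    (trans (cong length (trans (mapMaybe-++ departedItem (map arr (allFin n)) _)
      (cong₂ _++_ (arrs (allFin n)) (deps (allFin n))))) (trans (length-map toℕ (allFin n)) (length-tabulate {n = n} (λ j → j))))
    where
    arrs : ∀ js → departures (map arr js) ≡ []
    arrs []       = refl
    arrs (_ ∷ js) = arrs js
    deps : ∀ js → departures (map dep js) ≡ map toℕ js
    deps []       = refl
    deps (j ∷ js) = cong (toℕ j ∷_) (deps js)

  valid-events : Valid events
  valid-events = subst Unique (sym arrivals-events) (Unique.map⁺ Fin.toℕ-injective (Unique.allFin⁺ n))
    , All.++⁺ (All.map⁺ {f = arr} (All.tabulate {xs = allFin n} (λ {j} _ → 0≤size j , size≤1 j)))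
              (All.map⁺ {f = dep} (All.tabulate {xs = allFin n} (λ _ → tt)))

  valid-resp-↭ : ∀ {h h′} → h ↭ h′ → Valid h → Valid h′
  valid-resp-↭ h↭h′ (arrivals! , unit) = unique-resp-↭ (mapMaybe-↭ arrivedItem h↭h′) arrivals! , All-resp-↭ h↭h′ unit

  valid-filter : ∀ {p} {P : Pred Observation p} (P? : Decidable P) h → Valid h → Valid (filter P? h)
  valid-filter P? h (arrivals! , unit) = unique h arrivals! , All.filter⁺ P? unit
    where
    all : ∀ {q} {Q : Pred ℕ q} h → All Q (arrivals h) → All Q (arrivals (filter P? h))
    all []                    Qs       = Qs
    all (o ∷ h) Qs with P? o
    all (arrives _ _ _ ∷ h) (Qi ∷ Qs) | yes _ = Qi ∷ all h Qs
    all (arrives _ _ _ ∷ h) (Qi ∷ Qs) | no  _ = all h Qs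
    all (departs _ _ ∷ h)   Qs        | yes _ = all h Qs
    all (departs _ _ ∷ h)   Qs        | no  _ = all h Qs
    unique : ∀ h → Unique (arrivals h) → Unique (arrivals (filter P? h))
    unique [] u = u
    unique (o ∷ h) u with P? o
    unique (arrives _ _ _ ∷ h) (i∉ ∷ u) | yes _ = all h i∉ ∷ unique h u
    unique (arrives _ _ _ ∷ h) (i∉ ∷ u) | no  _ = unique h u
    unique (departs _ _ ∷ h)   u        | yes _ = unique h u
    unique (departs _ _ ∷ h)   u        | no  _ = unique h u

  valid-fullHistory : Valid (fullHistory I)
  valid-fullHistory = valid-resp-↭ (↭-sym fullHistory↭events) valid-events

  valid-historyAt : ∀ t → Valid (historyAt I t)
  valid-historyAt t = valid-resp-↭ (↭-sym (↭-reverse _))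
    (valid-filter (λ o → time o ≤? t) (timeline I) (valid-resp-↭ (↭-sym timeline↭events) valid-events))

  ≤ᵒ⇒time≤ : ∀ {o o′} → o ≤ᵒ o′ → time o ≤ time o′
  ≤ᵒ⇒time≤ {arrives _ _ _} {arrives _ _ _} (inj₁ (t≤ , _)) = t≤
  ≤ᵒ⇒time≤ {arrives _ _ _} {arrives _ _ _} (inj₂ (eq , _)) = ≤-reflexive eq
  ≤ᵒ⇒time≤ {arrives _ _ _} {departs _ _}   (inj₁ (t≤ , _)) = t≤
  ≤ᵒ⇒time≤ {arrives _ _ _} {departs _ _}   (inj₂ (eq , _)) = ≤-reflexive eq
  ≤ᵒ⇒time≤ {departs _ _}   {arrives _ _ _} (inj₁ (t≤ , _)) = t≤
  ≤ᵒ⇒time≤ {departs _ _}   {arrives _ _ _} (inj₂ (eq , _)) = ≤-reflexive eq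
  ≤ᵒ⇒time≤ {departs _ _}   {departs _ _}   (inj₁ (t≤ , _)) = t≤
  ≤ᵒ⇒time≤ {departs _ _}   {departs _ _}   (inj₂ (eq , _)) = ≤-reflexive eq

  -- At equal times departures come first, so a departure that follows an arrival in the order has a
  -- strictly later time.
  arrives≤ᵒdeparts⇒< : ∀ {t i s t′ i′} → arrives t i s ≤ᵒ departs t′ i′ → t < t′
  arrives≤ᵒdeparts⇒< (inj₁ t<t′)                  = t<t′
  arrives≤ᵒdeparts⇒< (inj₂ (_ , inj₁ (() , _)))
  arrives≤ᵒdeparts⇒< (inj₂ (_ , inj₂ (() , _)))

  arrival<departure : ∀ j → arrival j < departure j
  arrival<departure j = ≰⇒> λ dep≤arr → <⇒≱ (0<duration j) (+-cancelʳ-≤ (arrival j)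
    (≡-≤-trans (+-comm _ _) (≤-≡-trans dep≤arr (sym (+-identityˡ _)))))

  -- What survives when the latest observation is dropped. Such a history may stop in the midst of
  -- simultaneous observations; `closed` still guarantees that whoever departs no later than a
  -- recorded arrival has been removed.
  record Chronicle (h : History) : Set (c Level.⊔ ℓ) where
    field
      descending : AllPairs (λ o o′ → o′ ≤ᵒ o) h
      genuine    : ∀ {o} → o ∈ h → ∃[ j ] (o ≡ arr j ⊎ o ≡ dep j)
      closed     : ∀ {t i s} j → arrives t i s ∈ h → departure j ≤ t → dep j ∈ h
  open Chronicle

  chronicle-tail : ∀ {o h} → Chronicle (o ∷ h) → Chronicle h
  chronicle-tail {o} {h} ch with o≥h ∷ h↘ ← descending ch = record
    { descending = h↘
    ; genuine    = λ o∈ → genuine ch (there o∈)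
    ; closed     = closed′
    }
    where
    closed′ : ∀ {t i s} j → arrives t i s ∈ h → departure j ≤ t → dep j ∈ h
    closed′ {s = s} j a∈ d≤t with closed ch j (there a∈) d≤t
    ... | there d∈  = d∈
    -- The dropped observation would be the departure itself, but it follows the arrival in the
    -- order and so happens strictly later.
    ... | here refl = contradiction d≤t (<⇒≱ (arrives≤ᵒdeparts⇒< {s = s} (All.lookup o≥h a∈)))

  ∈-events⁻ : ∀ {o} → o ∈ events → ∃[ j ] (o ≡ arr j ⊎ o ≡ dep j)
  ∈-events⁻ o∈ with ∈-++⁻ (map arr (allFin n)) o∈
  ... | inj₁ o∈arr with j , _ , eq ← ∈-map⁻ arr o∈arr = j , inj₁ eq
  ... | inj₂ o∈dep with j , _ , eq ← ∈-map⁻ dep o∈dep = j , inj₂ eq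

  ∈-historyAt⁻ : ∀ {t o} → o ∈ historyAt I t → o ∈ events × time o ≤ t
  ∈-historyAt⁻ {t} o∈ with o∈′ , ≤t ← ∈-filter⁻ (λ o → time o ≤? t) (∈-resp-↭ (↭-reverse _) o∈) =
    ∈-resp-↭ timeline↭events o∈′ , ≤t

  dep∈historyAt : ∀ {t} j → departure j ≤ t → dep j ∈ historyAt I t
  dep∈historyAt {t} j ≤t = ∈-resp-↭ (↭-sym (↭-reverse _)) (∈-filter⁺ (λ o → time o ≤? t)
    (∈-resp-↭ (↭-sym timeline↭events) (∈-++⁺ʳ (map arr (allFin n)) (∈-map⁺ dep (∈-allFin j)))) ≤t)

  chronicle-historyAt : ∀ t → Chronicle (historyAt I t)
  chronicle-historyAt t = record
    { descending = allPairs-reverse _ (AllPairs.filter⁺ (λ o → time o ≤? t)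
        (Sorted.Sorted⇒AllPairs observationTotalOrder (Sort.sort-↗ observationOrder events)))
    ; genuine    = λ o∈ → ∈-events⁻ (proj₁ (∈-historyAt⁻ {t} o∈))
    ; closed     = λ j a∈ d≤ → dep∈historyAt j (≤-trans d≤ (proj₂ (∈-historyAt⁻ {t} a∈)))
    }

  alive-item : ∀ {h i s} → Chronicle h → Alive h i s → ∃[ j ] i ≡ toℕ j × s ≡ size j × arr j ∈ h × dep j ∉ h
  alive-item {h} ch now with genuine ch (here refl)
  ... | j , inj₂ ()
  ... | j , inj₁ refl = j , refl , refl , here refl , λ where
    (there d∈) → <⇒≱ (arrival<departure j) (≤ᵒ⇒time≤ {dep j} {arr j} (All.lookup (AllPairs.head (descending ch)) d∈))
  alive-item ch (later ¬departs alive) with alive-item (chronicle-tail ch) alive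
  ... | j , refl , refl , a∈ , d∉ = j , refl , refl , there a∈ , λ where
    (here refl) → ¬departs refl
    (there d∈)  → d∉ d∈

  -- The hypotheses cover two situations: the history at time t, and the history just after one
  -- arrival at t, when further arrivals at t may be outstanding.
  module _ (A : Algorithm) {h : History} {t : Carrier} (ch : Chronicle h)
    (≤t : ∀ {j} → arr j ∈ h → arrival j ≤ t) (≤t⇒∈ : ∀ {j} → departure j ≤ t → dep j ∈ h)
    (items! : Unique (map Placed.item (configuration A h))) where

    private
      C = configuration A h

      Matches : List Placed → List (Fin n) → Set c
      Matches C js = map Placed.item C ≡ map toℕ js × map Placed.size C ≡ map size js

      -- Recovers the items of the instance behind the indices and copied sizes, in the same order,
      -- so that uniqueness and sums carry over.
      match : ∀ D → (∀ {q} → q ∈ D → q ∈ C) → ∃[ js ] Matches D js × (∀ {j} → j ∈ js → j ∈ present t)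
      match []      _   = [] , (refl , refl) , λ ()
      match (q ∷ D) D⊆C with js , (items≡ , sizes≡) , js⊆ ← match D (λ q∈ → D⊆C (there q∈))
        with j , i≡ , s≡ , a∈ , d∉ ← alive-item ch (configuration-alive A h (D⊆C (here refl))) =
        j ∷ js , (cong₂ _∷_ i≡ items≡ , cong₂ _∷_ s≡ sizes≡) , λ where
          (here refl)  → ∈-filter⁺ (present? t) (∈-allFin j) (≤t a∈ , ≰⇒> (λ d≤t → d∉ (≤t⇒∈ d≤t)))
          (there j∈)   → js⊆ j∈

      matched : ∃[ js ] Matches C js × (∀ {j} → j ∈ js → j ∈ present t)
      matched = match C (λ q∈ → q∈)

      js : List (Fin n)
      js = proj₁ matched

      js! : Unique js
      js! = Unique.map⁻ (subst Unique (proj₁ (proj₁ (proj₂ matched))) items!)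

    length≤present : length C ℕ.≤ length (present t)
    length≤present = subst (ℕ._≤ length (present t)) (sym (trans (sym (length-map Placed.item C))
      (trans (cong length (proj₁ (proj₁ (proj₂ matched)))) (length-map toℕ js)))) (unique-⊆⇒length≤ js! (proj₂ (proj₂ matched)))

    sizes≤present : sum (map Placed.size C) ≤ sum (map size (present t))
    sizes≤present with zs , present↭ ← unique-⊆⇒↭ js! (proj₂ (proj₂ matched)) = begin
      sum (map Placed.size C)                  ≡⟨ cong sum (proj₂ (proj₁ (proj₂ matched))) ⟩
      sum (map size js)                        ≤⟨ x≤x+y (0≤sum size (All.tabulate {xs = zs} (λ {j} _ → 0≤size j))) ⟩
      sum (map size js) + sum (map size zs)    ≡⟨ sum-++ (map size js) (map size zs) ⟨
      sum (map size js ++ map size zs)         ≡⟨ cong sum (map-++ size js zs) ⟨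
      sum (map size (js ++ zs))                ≡⟨ sum-↭ (map⁺ size present↭) ⟨
      sum (map size (present t))               ∎

-- Lower bounds on OPT

module Packings {c ℓ} (F : OrderedField c ℓ) where
  open OrderedField F
  open BinPacking F
  open OrderedFieldProperties F
  open CommutativeRing commutativeRing using (*-identityˡ)

  packable⇒sum≤ : ∀ {sizes m} → All (0# ≤_) sizes → Packable sizes m → sum sizes ≤ fromℕ m
  packable⇒sum≤ {sizes} {m} 0≤sizes (packing , fits) = begin
    sum sizes                                          ≡⟨ cong sum (trans (map-tabulate (λ k → k) (lookup sizes)) (tabulate-lookup sizes)) ⟨
    sum (map (lookup sizes) ks)                        ≤⟨ sum≤Σfibres ks (allFin m) (All.tabulate (λ {k} _ → All.lookup 0≤sizes (∈-lookup k))) (All.tabulate (λ {k} _ → ∈-allFin (packing k))) ⟩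
    sum (map (λ b → fibreSum b ks) (allFin m))         ≡⟨ *-identityˡ _ ⟨
    1# * sum (map (λ b → fibreSum b ks) (allFin m))    ≤⟨ sum≤*length (λ b → fibreSum b ks) 1# (allFin m) (All.tabulate (λ {b} _ → ≡-≤-trans (*-identityˡ _) (fits b))) ⟩
    fromℕ (length (allFin m))                          ≡⟨ cong fromℕ (length-tabulate {n = m} (λ b → b)) ⟩
    fromℕ m                                            ∎
    where
    ks = allFin (length sizes)
    open Fibres Fin._≟_ packing (lookup sizes)

  -- Items of size 0 need a bin too, which the bound by total size does not see.
  packable-zero : ∀ {sizes} → Packable sizes 0 → length sizes ≡ 0
  packable-zero {[]}    _ = refl
  packable-zero {_ ∷ _} (packing , _) with () ← packing Fin.zero

-- Counting open bins

module BinCount {c ℓ} {F : OrderedField c ℓ} {α δ : OrderedField.Carrier F} (admissible : Admissible F α δ) where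
  open OrderedField F
  open Admissible admissible using (0≤α)
  open BinPacking F
  open OrderedFieldProperties F
  open Configurations F
  open FirstFitByClass F α
  open Placed
  open Proper
  open Fibres ℕ._≟_ bin size using (Σfibres≤sum)
  open CommutativeRing commutativeRing using (*-identityˡ)

  tags : ℕ → List Tag
  tags J = map inj₁ (upTo (suc J)) ++ map inj₂ (upTo (suc J))

  ∈-tags⁺ : ∀ {J} κ → level κ ℕ.≤ J → κ ∈ tags J
  ∈-tags⁺ (tiny j)    j≤J = ∈-++⁺ˡ (∈-map⁺ inj₁ (∈-upTo⁺ (s≤s j≤J)))
  ∈-tags⁺ {J} (regular k) k≤J = ∈-++⁺ʳ (map inj₁ (upTo (suc J))) (∈-map⁺ inj₂ (∈-upTo⁺ (s≤s k≤J)))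

  length-tags : ∀ J → length (tags J) ≡ suc J ℕ.+ suc J
  length-tags J = trans (length-++ (map inj₁ (upTo (suc J))))
    (cong₂ ℕ._+_ (trans (length-map inj₁ (upTo (suc J))) (length-upTo (suc J)))
                 (trans (length-map inj₂ (upTo (suc J))) (length-upTo (suc J))))

  -- Bins that are not light each account for α of the total size. Light bins have distinct tags by
  -- `OneLight`, and there are J + 1 tags of either kind.
  openBins≤ : ∀ {C J} → Proper C → OneLight C → (∀ {x} → x ∈ labels C → level (tag x) ℕ.≤ J) →
    α * fromℕ (openBins C) ≤ sum (map size C) + α * fromℕ (suc J ℕ.+ suc J)
  openBins≤ {C} {J} ok light! level≤ = begin
    α * fromℕ (length bs)                                  ≡⟨ cong (λ k → α * fromℕ k) (length-filter-split light? bs) ⟩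
    α * fromℕ (length light ℕ.+ length heavy)              ≡⟨ cong (α *_) (fromℕ-+ (length light) (length heavy)) ⟩
    α * (fromℕ (length light) + fromℕ (length heavy))      ≡⟨ solve 3 (λ α l h → α :* (l :+ h) := α :* h :+ α :* l) refl α (fromℕ (length light)) (fromℕ (length heavy)) ⟩
    α * fromℕ (length heavy) + α * fromℕ (length light)    ≤⟨ +-mono-≤ heavy≤ (*-monoˡ-≤ 0≤α (fromℕ-mono-≤ light≤)) ⟩
    sum (map size C) + α * fromℕ (suc J ℕ.+ suc J)         ∎
    where
    bs = deduplicate ℕ._≟_ (labels C)
    light? : ∀ b → Dec (load b C < α)
    light? b = load b C <? α
    light = filter light? bs
    heavy = filter (λ b → ¬? (light? b)) bs
    heavy≤ : α * fromℕ (length heavy) ≤ sum (map size C)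
    heavy≤ = begin
      α * fromℕ (length heavy)                   ≤⟨ length*≤sum (λ b → load b C) 1# heavy (All.tabulate α≤) ⟩
      1# * sum (map (λ b → load b C) heavy)      ≡⟨ *-identityˡ _ ⟩
      sum (map (λ b → load b C) heavy)           ≤⟨ Σfibres≤sum C heavy (nonneg ok) (Unique.filter⁺ _ (UniqueDec.deduplicate-! ℕ._≟_ (labels C))) ⟩
      sum (map size C)                           ∎
      where
      α≤ : ∀ {b} → b ∈ heavy → α ≤ 1# * load b C
      α≤ {b} b∈ with total α (load b C)
      ... | inj₁ ≤load = ≤-≡-trans ≤load (sym (*-identityˡ _))
      ... | inj₂ load≤ with load b C ≟ α
      ...   | yes eq = ≤-reflexive (trans (sym eq) (sym (*-identityˡ _)))
      ...   | no ≢α = contradiction (load≤ , ≢α) (proj₂ (∈-filter⁻ (λ b → ¬? (light? b)) {xs = bs} b∈))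
    light⁻ : ∀ {b} → b ∈ light → b ∈ labels C × load b C < α
    light⁻ b∈ with b∈bs , b<α ← ∈-filter⁻ light? b∈ = ∈-deduplicate⁻ ℕ._≟_ (labels C) b∈bs , b<α
    light≤ : length light ℕ.≤ suc J ℕ.+ suc J
    light≤ = subst₂ ℕ._≤_ (length-map tag light) (length-tags J) (unique-⊆⇒length≤
      (unique-map⁺ (Unique.filter⁺ light? (UniqueDec.deduplicate-! ℕ._≟_ (labels C)))
        (λ x∈ y∈ same → light! (proj₁ (light⁻ x∈)) (proj₁ (light⁻ y∈)) same (proj₂ (light⁻ x∈)) (proj₂ (light⁻ y∈))))
      ⊆tags)
      where
      ⊆tags : ∀ {κ} → κ ∈ map tag light → κ ∈ tags J
      ⊆tags κ∈ with b , b∈ , refl ← ∈-map⁻ tag κ∈ = ∈-tags⁺ (tag b) (level≤ (proj₁ (light⁻ b∈)))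

-- The two bounds for an instance

module Guarantee {c ℓ} {F : OrderedField c ℓ} {α δ : OrderedField.Carrier F} (admissible : Admissible F α δ) where
  open OrderedField F
  open Admissible admissible
  open BinPacking F
  open OrderedFieldProperties F
  open Configurations F
  open FirstFitByClass F α
  open Histories F
  open Packings F
  open Accounting admissible
  open BinCount admissible
  open CommutativeRing commutativeRing using (*-identityˡ; *-assoc; distribˡ)
  open Invariant
  open Proper

  module _ {n : ℕ} (I : Instance n) where
    open Instances F I
    open Instance I

    migrations≤ : fromℕ (migrations algorithm (fullHistory I)) ≤ (fromℕ 4 * α) / δ * fromℕ n
    migrations≤ = *-cancelˡ-≤ 0<δ (begin
      -- Credits left unspent at the end are given away.
      δ * fromℕ M                                       ≤⟨ x≤x+y (*-nonneg 0≤4α (0≤fromℕ (length departed))) ⟩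
      δ * fromℕ M + 4α * fromℕ (length departed)        ≤⟨ budget ⟩
      4α * fromℕ (length (departures (fullHistory I)))  ≡⟨ cong₂ (λ x k → x * fromℕ k) (sym (4*x α)) length-departures ⟩
      fromℕ 4 * α * fromℕ n                             ≡⟨ cong (_* fromℕ n) (x*[y/x]≡y 0<δ) ⟨
      δ * ((fromℕ 4 * α) / δ) * fromℕ n                 ≡⟨ *-assoc δ _ _ ⟩
      δ * ((fromℕ 4 * α) / δ * fromℕ n)                 ∎)
      where
      M = migrations algorithm (fullHistory I)
      open Credits (credits (invariant (fullHistory I) valid-fullHistory))

    state-items! : ∀ {h} → Invariant h → Unique (map Placed.item (configuration algorithm h))
    state-items! {h} inv = subst (λ C → Unique (map Placed.item C)) (sym (configuration≡state h)) (items! (proper inv))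

    module _ {ρ : ℕ} (peak : ∀ t → length (present t) ℕ.≤ ρ) where

      -- A tag is fixed by its label, so its level is checked when an item is placed: it is at most
      -- the logarithm of the number of items then present, the new one included, which is at most
      -- ρ.
      levels≤ : ∀ h → Chronicle h → Valid h → ∀ {x} → x ∈ labels (state h) → level (tag x) ℕ.≤ ⌊log₂ ρ ⌋
      levels≤ (departs _ i ∷ past) ch (arrivals! , _ ∷ unit) x∈ =
        levels≤ past (chronicle-tail ch) (arrivals! , unit)
          (departure-labels α+α<1 i (proper (invariant past (arrivals! , unit))) x∈)
      levels≤ (arrives _ _ _ ∷ past) ch (_ ∷ arrivals! , _ ∷ unit) (there x∈) =
        levels≤ past (chronicle-tail ch) (arrivals! , unit) x∈
      levels≤ h@(arrives t i s ∷ past) ch valid (here refl) =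
        subst (λ κ → level κ ℕ.≤ ⌊log₂ ρ ⌋) (sym (choose-tag (state past) s))
          (ℕ.≤-trans (scan-level ⌊log₂ suc (length (state past)) ⌋ 0 s)
          (ℕ.≤-trans (ℕ.≤-reflexive (ℕ.+-identityʳ _)) (⌊log₂⌋-mono-≤ (ℕ.≤-trans few (peak t)))))
        where
        open Chronicle
        ≤t : ∀ {j} → arr j ∈ h → arrival j ≤ t
        ≤t (here refl) = ≤-refl
        ≤t {j} (there a∈) = ≤ᵒ⇒time≤ {arr j} {arrives t i s} (All.lookup (AllPairs.head (descending ch)) a∈)
        few : suc (length (state past)) ℕ.≤ length (present t)
        few = ℕ.≤-trans (ℕ.≤-reflexive (cong length (sym (configuration≡state h))))
          (length≤present algorithm {t = t} ch ≤t (closed ch _ (here refl)) (state-items! (invariant h valid)))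

      openBins≤opt : ∀ t opt → IsOPT I t opt →
        fromℕ (openBins (configuration algorithm (historyAt I t))) ≤ 1# / α * fromℕ opt + fromℕ (4 ℕ.* ⌊log₂ ρ ⌋)
      openBins≤opt t opt (packable , _) = *-cancelˡ-≤ 0<α (begin
        α * fromℕ (openBins C)                     ≤⟨ bound (ρ ℕ.≤? 1) ⟩
        fromℕ opt + α * extra                      ≡⟨ cong (_+ α * extra) (*-identityˡ _) ⟨
        1# * fromℕ opt + α * extra                 ≡⟨ cong (λ x → x * fromℕ opt + α * extra) (x*[y/x]≡y 0<α) ⟨
        α * (1# / α) * fromℕ opt + α * extra       ≡⟨ cong (_+ α * extra) (*-assoc α _ _) ⟩
        α * (1# / α * fromℕ opt) + α * extra       ≡⟨ distribˡ α _ _ ⟨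
        α * (1# / α * fromℕ opt + extra)           ∎)
        where
        h = historyAt I t
        inv = invariant h (valid-historyAt t)
        C = configuration algorithm h
        extra = fromℕ (4 ℕ.* ⌊log₂ ρ ⌋)
        ≤t : ∀ {j} → arr j ∈ h → arrival j ≤ t
        ≤t a∈ = proj₂ (∈-historyAt⁻ {t} a∈)
        few : length C ℕ.≤ length (present t)
        few = length≤present algorithm (chronicle-historyAt t) ≤t (dep∈historyAt _) (state-items! inv)
        small : sum (map Placed.size C) ≤ fromℕ opt
        small = ≤-trans (sizes≤present algorithm (chronicle-historyAt t) ≤t (dep∈historyAt _) (state-items! inv))
          (packable⇒sum≤ {map size (present t)} (All.map⁺ (All.tabulate {xs = present t} (λ {j} _ → 0≤size j))) packable)
        open≤opt : ρ ℕ.≤ 1 → openBins C ℕ.≤ opt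
        open≤opt ρ≤1 = ℕ.≤-trans (length-deduplicate ℕ._≟_ (labels C))
          (ℕ.≤-trans (ℕ.≤-reflexive (length-map Placed.bin C)) (ℕ.≤-trans few (go opt packable)))
          where
          go : ∀ m → Packable (map size (present t)) m → length (present t) ℕ.≤ m
          go zero    p = ℕ.≤-reflexive (trans (sym (length-map size (present t))) (packable-zero {map size (present t)} p))
          go (suc m) p = ℕ.≤-trans (peak t) (ℕ.≤-trans ρ≤1 (s≤s z≤n))
        α≤1 : α ≤ 1#
        α≤1 = ≤-trans (x≤x+y 0≤α) (proj₁ α+α<1)
        0≤α*extra : 0# ≤ α * extra
        0≤α*extra = *-nonneg 0≤α (0≤fromℕ (4 ℕ.* ⌊log₂ ρ ⌋))
        bound : Dec (ρ ℕ.≤ 1) → α * fromℕ (openBins C) ≤ fromℕ opt + α * extra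
        -- Here the logarithm is 0 and leaves no room for light bins; but at most one item is
        -- present, so the open bins are no more than OPT.
        bound (yes ρ≤1) = begin
          α * fromℕ (openBins C)       ≤⟨ *-monoʳ-≤ (0≤fromℕ (openBins C)) α≤1 ⟩
          1# * fromℕ (openBins C)      ≡⟨ *-identityˡ _ ⟩
          fromℕ (openBins C)           ≤⟨ fromℕ-mono-≤ (open≤opt ρ≤1) ⟩
          fromℕ opt                    ≤⟨ x≤x+y 0≤α*extra ⟩
          fromℕ opt + α * extra        ∎
        bound (no ρ≰1) = begin
          α * fromℕ (openBins C)                                     ≤⟨ subst (λ C → α * fromℕ (openBins C) ≤ sum (map Placed.size C) + α * fromℕ (suc J ℕ.+ suc J))
                                                                          (sym (configuration≡state h)) (openBins≤ (proper inv) (oneLight inv) (levels≤ h (chronicle-historyAt t) (valid-historyAt t))) ⟩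
          sum (map Placed.size C) + α * fromℕ (suc J ℕ.+ suc J)      ≤⟨ +-mono-≤ small (*-monoˡ-≤ 0≤α (fromℕ-mono-≤ 2+2J≤4J)) ⟩
          fromℕ opt + α * extra                                      ∎
          where
          J = ⌊log₂ ρ ⌋
          1≤J : 1 ℕ.≤ J
          1≤J = ⌊log₂⌋-mono-≤ (ℕ.≰⇒> ρ≰1)
          -- The origin of the absolute constant 4: with J ≥ 1 the two summands 1 are absorbed by J
          -- each.
          2+2J≤4J : suc J ℕ.+ suc J ℕ.≤ 4 ℕ.* J
          2+2J≤4J = ℕ.≤-trans (ℕ.+-mono-≤ (ℕ.+-monoˡ-≤ J 1≤J) (ℕ.+-monoˡ-≤ J 1≤J))
            (ℕ.≤-reflexive (sym (trans (ℕ.*-distribʳ-+ J 2 2) (cong (λ k → k ℕ.+ k) (cong (J ℕ.+_) (ℕ.+-identityʳ J))))))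

theorem2 : ∀ {c ℓ} (F : OrderedField c ℓ) →
    let open OrderedField F
        open BinPacking F
    in
    Σ[ K ∈ ℕ ]
      (∀ (α : Carrier) → 0# < α → α < 1# / fromℕ 2 →
       Σ[ A ∈ Algorithm ]
         (∀ (n : ℕ) (I : Instance n) →
            Legal A (fullHistory I)
          × fromℕ (migrations A (fullHistory I)) ≤ (fromℕ 4 * α) / (1# - fromℕ 2 * α) * fromℕ n
          × (∀ (ρ : ℕ) → IsPeak I ρ →
             ∀ (t : Carrier) (opt : ℕ) → IsOPT I t opt →
               fromℕ (openBins (configuration A (historyAt I t)))
                 ≤ (1# / α) * fromℕ opt + fromℕ (K ℕ.* ⌊log₂ ρ ⌋))))
theorem2 F = 4 , λ α 0<α α<½ →
  let δ = 1# - fromℕ 2 * α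
      δ+2α≡1 : δ + (α + α) ≡ 1#
      δ+2α≡1 = trans (cong (δ +_) (sym (2*x α))) (trans (+-assoc 1# _ _) (trans (cong (1# +_) (-‿inverseˡ _)) (+-identityʳ 1#)))
      -- `pow2 1` computes to `fromℕ 2`, so its positivity permits doubling the hypothesis on α.
      α+α<1 : α + α < 1#
      α+α<1 = ≰⇒> λ 1≤2α → <⇒≱ α<½ (*-cancelˡ-≤ (0<pow2 1) (≡-≤-trans (x*[y/x]≡y (0<pow2 1)) (≤-≡-trans 1≤2α (sym (2*x α)))))
      0<δ : 0# < δ
      0<δ = ≰⇒> λ δ≤0 → <⇒≱ α+α<1 (≡-≤-trans (sym δ+2α≡1) (≤-≡-trans (+-monoˡ-≤ (α + α) δ≤0) (+-identityˡ _)))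
      admissible : Admissible F α δ
      admissible = record { 0<α = 0<α ; 0<δ = 0<δ ; δ+2α≡1 = δ+2α≡1 ; α+α<1 = α+α<1 }
      open Guarantee admissible
      open Accounting admissible
  in FirstFitByClass.algorithm F α , λ n I →
       Invariant.legal (invariant (fullHistory I) (Instances.valid-fullHistory F I))
     , migrations≤ I
     , λ ρ (_ , greatest) → openBins≤opt I (λ t → greatest _ (t , refl))
  where
  open OrderedField F
  open BinPacking F
  open OrderedFieldProperties F
  open CommutativeRing commutativeRing using (+-assoc; +-identityˡ; +-identityʳ; -‿inverseˡ)
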